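{- For every triangle-free graph $G$ with maximum degree $\Delta$, \[ \chi_{DP}(G) \leq (1+o(1)) \frac{\Delta}{\ln \Delta}. \]
   Context: Here $o(1)$ denotes a function of $\Delta$ alone that tends to $0$ as $\Delta \to \infty$. All graphs are finite, undirected and simple. A cover of a graph $G$ is a pair $(L,H)$ where $H$ is a graph and $L\colon V(G)\to 2^{V(H)}$ is such that: (C1) the sets $L(u)$, $u\in V(G)$, partition $V(H)$; (C2) each $H[L(u)]$ is a complete graph; (C3) if there is an edge of $H$ between $L(u)$ and $L(v)$ then $u=v$ or $uv\in E(G)$; (C4) if $uv\in E(G)$ then the set of edges of $H$ between $L(u)$ and $L(v)$ is a matching (possibly empty, not necessarily perfect). The cover is $k$-fold if $|L(u)|=k$ for all $u$. An $(L,H)$-coloring of $G$ is an independent set in $H$ of size $|V(G)|$ (equivalently, an independent set meeting each $L(u)$ in exactly one vertex). The DP-chromatic number $\chi_{DP}(G)$ is the least $k\in\mathbb{N}$ such that $G$ has an $(L,H)$-coloring for every $k$-fold cover $(L,H)$ of $G$. -}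

module Defs where

open import Data.Nat using (ℕ; zero; suc; _≤_) renaming (_^_ to _^ℕ_)
open import Data.Fin using (Fin)
open import Data.Bool using (Bool; true; false)
open import Data.List using (List; filter; length)
open import Data.List using () renaming (allFin to allFinL)
open import Data.Product using (Σ; ∃; _×_; _,_)
open import Data.Empty using (⊥)
open import Data.Integer using (+_)
open import Data.Rational using (ℚ; _+_; _*_; _/_; 0ℚ; 1ℚ) renaming (_≤_ to _≤ℚ_; _<_ to _<ℚ_)
open import Relation.Binary.PropositionalEquality using (_≡_; _≢_)
open import Relation.Nullary using (¬_)
open import Relation.Nullary.Decidable using (does)
open import Data.Bool using (T)

record Graph (n : ℕ) : Set where
  field
    adj     : Fin n → Fin n → Bool
    symm    : ∀ u v → adj u v ≡ adj v u
    irrefl  : ∀ u → adj u u ≡ false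

open Graph public

degree : ∀ {n} → Graph n → Fin n → ℕ
degree {n} G u = length (filter (λ v → T? (adj G u v)) (allFinL n))
  where
  open import Data.Bool.Properties using (T?)

MaxDegree : ∀ {n} → Graph n → ℕ → Set
MaxDegree {zero}  G Δ = Δ ≡ 0
MaxDegree {suc n} G Δ = (∀ u → degree G u ≤ Δ) × ∃ λ u → degree G u ≡ Δ

TriangleFree : ∀ {n} → Graph n → Set
TriangleFree {n} G =
  ∀ (u v w : Fin n) → adj G u v ≡ true → adj G v w ≡ true → adj G u w ≡ true → ⊥

-- k-fold covers.  Up to relabelling, V(H) = Fin n × Fin k with
-- L(u) = {u} × Fin k, which gives (C1) and |L(u)| = k.
-- H is given by a Bool-valued adjacency hadj u i v j  ("(u,i) ~ (v,j)").

record Cover {n : ℕ} (G : Graph n) (k : ℕ) : Set where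
  field
    hadj    : Fin n → Fin k → Fin n → Fin k → Bool
    hsymm   : ∀ u i v j → hadj u i v j ≡ hadj v j u i
    hirrefl : ∀ u i → hadj u i u i ≡ false
    clique  : ∀ u i j → i ≢ j → hadj u i u j ≡ true
    respect : ∀ u i v j → u ≢ v → hadj u i v j ≡ true → adj G u v ≡ true
    matchL  : ∀ u i v j j' → u ≢ v → hadj u i v j ≡ true → hadj u i v j' ≡ true → j ≡ j'
    matchR  : ∀ u i i' v j → u ≢ v → hadj u i v j ≡ true → hadj u i' v j ≡ true → i ≡ i'

open Cover public

-- An (L,H)-coloring: an independent set of H meeting each L(u) in exactly
-- one vertex, i.e. a choice f u ∈ L(u) with no H-edges among the chosen vertices.
CoverColoring : ∀ {n k} {G : Graph n} → Cover G k → Set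
CoverColoring {n} {k} C =
  Σ (Fin n → Fin k) λ f → ∀ u v → hadj C u (f u) v (f v) ≡ false

DPColorable : ∀ {n} → Graph n → ℕ → Set
DPColorable G k = (C : Cover G k) → CoverColoring C

-- χ_DP(G) ≤ b  (χ_DP is the least such k, so this holds iff some k ≤ b works).
-- Here the bound is given as a predicate on k.

expTerm : ℚ → ℕ → ℚ
expTerm x zero    = 1ℚ
expTerm x (suc i) = expTerm x i * x * ((+ 1) / suc i)

expPartial : ℚ → ℕ → ℚ
expPartial x zero    = 1ℚ
expPartial x (suc N) = expPartial x N + expTerm x (suc N)

-- q ≤ e^x   (as real numbers), since e^x = lim_N expPartial x N
_≤exp_ : ℚ → ℚ → Set
q ≤exp x = ∀ (δ : ℚ) → 0ℚ <ℚ δ → ∃ λ N → q ≤ℚ expPartial x N + δ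

ℕtoℚ : ℕ → ℚ
ℕtoℚ m = (+ m) / 1

{-# OPTIONS --safe #-}

{-
Rosenfeld's counting method: if v ∉ S then the number of colorings of S ∪ {v} is at least ℓ times that
of S, by induction on |S|.  Fix the colors of S outside N(v).  As N(v) is independent, its vertices then
choose freely from their remaining lists L_u, so the number of ways to color N(v) ∪ {v} is the sum over
the colors i of v of ∏_u (|L_u| − b_{u,i}), where b_{u,i} = 1 if i conflicts with a color in L_u and
0 otherwise.  Each u conflicts with at most |L_u| colors, so if all |L_u| ≥ t then AM–GM over i bounds
this below by k (1 − 1/t)^{tΔ/k} ∏_u |L_u| ≈ k e^{−Δ/k} ∏_u |L_u|, which exceeds 2ℓ ∏_u |L_u| for
k = (1 + ε) Δ / ln Δ and ℓ a small power of Δ.  Lists with |L_u| < t are rare by the induction hypothesis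
applied to S − u: typically there are at most θ = O(Δ/ℓ) of them, and giving up the at most tθ colors
in conflict with them is harmless.
-}
module Submission where

open import Defs

-- A list with a single color left can make a factor |L_u| - b_{u,i} vanish, and then AM-GM gives
-- nothing; this is what forces the separate treatment of short lists. Longer lists are controlled
-- by the growth of (1 - 1/n)^n in n: if |L_u| ≥ t, then u keeps at least the proportion (1 - 1/t)^t
-- of its product over i. Averages are unnormalized sums over colorings, and the estimate for one
-- coloring is a linear inequality that holds whether or not short lists are few, so that it can be
-- summed. The factor 2 in 2ℓ is the price: one half covers the colorings with many short lists, the
-- other half is the claim. Logarithms and roots become comparisons of natural powers. With s = t -
-- 1 and 2/s ≤ ε, k is the largest number with Δ^k ≤ (1 + 1/s)^{(s+2)Δ}; the right side is at most
-- e^{(1+2/s)Δ}.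

module Inequalities where

  open import Data.Bool using (if_then_else_; true; false)
  open import Data.List using (List; []; _∷_; length; map; filter)
  open import Data.List.Membership.Propositional using (_∈_)
  open import Data.List.Membership.Propositional.Properties using (∈-filter⁻)
  open import Data.List.Properties using (map-cong; length-map)
  open import Data.List.Relation.Unary.Any using (here; there)
  open import Data.Nat
  open import Data.Nat.ListAction using (sum; product)
  open import Data.Nat.Properties
  open import Data.Nat.Tactic.RingSolver using (solve-∀)
  open import Data.Product using (_,_; _×_; proj₂)
  open import Data.Sum using (_⊎_; inj₁; inj₂)
  open import Function using (_∘_)
  open import Relation.Binary.PropositionalEquality
  open import Relation.Nullary using (Dec; yes; no; ofʸ; ofⁿ; contradiction)

  -- Bernoulli, AM-GM and the monotonicity of (1 - 1/n)^n in natural numbers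

  ^-distrib-* : ∀ a b n → (a * b) ^ n ≡ a ^ n * b ^ n
  ^-distrib-* a b zero    = refl
  ^-distrib-* a b (suc n) = trans (cong (a * b *_) (^-distrib-* a b n)) (lem a b (a ^ n) (b ^ n))
    where
    lem : ∀ a b x y → a * b * (x * y) ≡ a * x * (b * y)
    lem = solve-∀

  bernoulli : ∀ a d n → a ^ n * (a + suc n * d) ≤ (a + d) ^ suc n
  bernoulli a d zero    = ≤-reflexive (lem a d)
    where
    lem : ∀ a d → 1 * (a + (d + 0)) ≡ (a + d) * 1
    lem = solve-∀
  bernoulli a d (suc n) = begin
    a * a ^ n * (a + suc (suc n) * d)                       ≤⟨ m≤m+n _ (a ^ n * (suc n * d * d)) ⟩
    a * a ^ n * (a + suc (suc n) * d) + a ^ n * (suc n * d * d) ≡⟨ lem a d (a ^ n) (suc n) ⟩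
    (a + d) * (a ^ n * (a + suc n * d))                     ≤⟨ *-monoʳ-≤ (a + d) (bernoulli a d n) ⟩
    (a + d) * (a + d) ^ suc n                               ∎
    where
    open ≤-Reasoning
    lem : ∀ a d p n → a * p * (a + (d + n * d)) + p * (n * d * d) ≡ (a + d) * (p * (a + n * d))
    lem = solve-∀

  -- Bernoulli for a decrease: (1 - d/B)^(n+1) ≥ 1 - (n+1)d/B with B = c + d, arranged so that
  -- nothing is subtracted.
  pow-diff : ∀ c d n → (c + d) ^ suc n ≤ c ^ suc n + suc n * d * (c + d) ^ n
  pow-diff c d zero    = ≤-reflexive (lem c d)
    where
    lem : ∀ c d → (c + d) * 1 ≡ c * 1 + (d + 0) * 1
    lem = solve-∀
  pow-diff c d (suc n) = begin
    (c + d) * (c + d) ^ suc n                                         ≤⟨ *-monoʳ-≤ (c + d) (pow-diff c d n) ⟩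
    (c + d) * (c ^ suc n + suc n * d * (c + d) ^ n)                   ≡⟨ lem c d (c ^ suc n) (suc n) ((c + d) ^ n) ⟩
    c * c ^ suc n + suc n * d * ((c + d) * (c + d) ^ n) + d * c ^ suc n
      ≤⟨ +-monoʳ-≤ (c * c ^ suc n + suc n * d * (c + d) ^ suc n) (*-monoʳ-≤ d (^-monoˡ-≤ (suc n) (m≤m+n c d))) ⟩
    c * c ^ suc n + suc n * d * (c + d) ^ suc n + d * (c + d) ^ suc n ≡⟨ lem₂ (c * c ^ suc n) d (suc n) ((c + d) ^ suc n) ⟩
    c ^ suc (suc n) + suc (suc n) * d * (c + d) ^ suc n               ∎
    where
    open ≤-Reasoning
    lem : ∀ c d p n q → (c + d) * (p + n * d * q) ≡ c * p + n * d * ((c + d) * q) + d * p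
    lem = solve-∀
    lem₂ : ∀ p d n q → p + n * d * q + d * q ≡ p + (d + n * d) * q
    lem₂ = solve-∀

  -- AM–GM for n copies of a and one y, multiplied out by (n+1)^(n+1).
  weighted-am-gm : ∀ n a y → suc n ^ suc n * (a ^ n * y) ≤ (n * a + y) ^ suc n
  weighted-am-gm n a y with ≤-total a y
  -- Both cases are Bernoulli at (n+1)a with increment y - a; its sign selects `bernoulli` or
  -- `pow-diff`.
  ... | inj₁ a≤y with d , refl ← m≤n⇒∃[o]m+o≡n a≤y = begin
    suc n ^ suc n * (a ^ n * (a + d))            ≡⟨ lem (suc n) (suc n ^ n) (a ^ n) a d ⟩
    suc n ^ n * a ^ n * (suc n * a + suc n * d)  ≡⟨ cong (_* (suc n * a + suc n * d)) (^-distrib-* (suc n) a n) ⟨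
    (suc n * a) ^ n * (suc n * a + suc n * d)    ≤⟨ bernoulli (suc n * a) d n ⟩
    (suc n * a + d) ^ suc n                      ≡⟨ cong (_^ suc n) (lem₂ n a d) ⟩
    (n * a + (a + d)) ^ suc n                    ∎
    where
    open ≤-Reasoning
    lem : ∀ m p q a d → m * p * (q * (a + d)) ≡ p * q * (m * a + m * d)
    lem = solve-∀
    lem₂ : ∀ n a d → a + n * a + d ≡ n * a + (a + d)
    lem₂ = solve-∀
  ... | inj₂ y≤a with d , refl ← m≤n⇒∃[o]m+o≡n y≤a = +-cancelʳ-≤ (suc n * d * B ^ n) _ _ (begin
    suc n ^ suc n * (a ^ n * y) + suc n * d * B ^ n
      ≡⟨ cong (λ z → suc n ^ suc n * (a ^ n * y) + suc n * d * z) (^-distrib-* (suc n) a n) ⟩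
    suc n ^ suc n * (a ^ n * y) + suc n * d * (suc n ^ n * a ^ n)
      ≡⟨ lem (suc n) (suc n ^ n) (a ^ n) y d ⟩
    suc n * a * (suc n ^ n * a ^ n)         ≡⟨ cong (suc n * a *_) (^-distrib-* (suc n) a n) ⟨
    B ^ suc n                               ≡⟨ cong (_^ suc n) (lem₂ n y d) ⟩
    (c + d) ^ suc n                         ≤⟨ pow-diff c d n ⟩
    c ^ suc n + suc n * d * (c + d) ^ n     ≡⟨ cong (λ z → c ^ suc n + suc n * d * z ^ n) (lem₂ n y d) ⟨
    c ^ suc n + suc n * d * B ^ n           ∎)
    where
    open ≤-Reasoning
    B = suc n * a
    c = n * a + y
    lem : ∀ m p q y d → m * p * (q * y) + m * d * (p * q) ≡ m * (y + d) * (p * q)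
    lem = solve-∀
    lem₂ : ∀ n y d → y + d + n * (y + d) ≡ n * (y + d) + y + d
    lem₂ = solve-∀

  -- Induction through `weighted-am-gm` with everything scaled by n: `sum xs` is n times the mean of
  -- `xs`, and x becomes `n * x`. Cancelling n^(n+1) requires n ≥ 1, whence the singleton case.
  am-gm : ∀ xs → length xs ^ length xs * product xs ≤ sum xs ^ length xs
  am-gm []           = ≤-refl
  am-gm (x ∷ [])     = ≤-reflexive (lem x)
    where
    lem : ∀ x → 1 * (x * 1) ≡ (x + 0) * 1
    lem = solve-∀
  am-gm (x ∷ xs@(_ ∷ ys)) = *-cancelˡ-≤ (n * n ^ n) {{m*n≢0 n (n ^ n) {{_}} {{m^n≢0 n n}}}} (begin
    n * n ^ n * (suc n ^ suc n * (x * product xs)) ≡⟨ lem n (n ^ n) (suc n ^ suc n) x (product xs) ⟩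
    suc n ^ suc n * (n ^ n * product xs * (n * x)) ≤⟨ *-monoʳ-≤ (suc n ^ suc n) (*-monoˡ-≤ (n * x) (am-gm xs)) ⟩
    suc n ^ suc n * (sum xs ^ n * (n * x))         ≤⟨ weighted-am-gm n (sum xs) (n * x) ⟩
    (n * sum xs + n * x) ^ suc n                   ≡⟨ cong (_^ suc n) (lem₂ n (sum xs) x) ⟩
    (n * (x + sum xs)) ^ suc n                     ≡⟨ ^-distrib-* n (x + sum xs) (suc n) ⟩
    n * n ^ n * (x + sum xs) ^ suc n               ∎)
    where
    open ≤-Reasoning
    n = length xs
    lem : ∀ n p q x r → n * p * (q * (x * r)) ≡ q * (p * r * (n * x))
    lem = solve-∀
    lem₂ : ∀ n s x → n * s + n * x ≡ n * (x + s)
    lem₂ = solve-∀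

  -- AM-GM for n = M + 1 copies of 1 - 1/n and a single 1, whose mean is 1 - 1/(n+1).
  [1-1/n]^n-step : ∀ M → M ^ suc M * suc (suc M) ^ suc (suc M) ≤ suc M ^ suc M * suc M ^ suc (suc M)
  [1-1/n]^n-step M = *-cancelˡ-≤ (suc M) (begin
    suc M * (M ^ suc M * q)                        ≡⟨ lem (suc M) (M ^ suc M) q ⟩
    q * (M ^ suc M * suc M)                        ≤⟨ weighted-am-gm (suc M) M (suc M) ⟩
    (suc M * M + suc M) ^ suc (suc M)              ≡⟨ cong (_^ suc (suc M)) (lem₂ M) ⟩
    (suc M * suc M) ^ suc (suc M)                  ≡⟨ ^-distrib-* (suc M) (suc M) (suc (suc M)) ⟩
    suc M * suc M ^ suc M * suc M ^ suc (suc M)    ≡⟨ *-assoc (suc M) (suc M ^ suc M) _ ⟩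
    suc M * (suc M ^ suc M * suc M ^ suc (suc M))  ∎)
    where
    open ≤-Reasoning
    q = suc (suc M) ^ suc (suc M)
    lem : ∀ m p q → m * (p * q) ≡ q * (p * m)
    lem = solve-∀
    lem₂ : ∀ M → suc M * M + suc M ≡ suc M * suc M
    lem₂ = solve-∀

  [1-1/n]^n-mono : ∀ s d → s ^ suc s * suc (d + s) ^ suc (d + s) ≤ suc s ^ suc s * (d + s) ^ suc (d + s)
  [1-1/n]^n-mono s zero    = ≤-reflexive (*-comm (s ^ suc s) _)
  [1-1/n]^n-mono s (suc d) = *-cancelʳ-≤ _ _ (suc M ^ suc M) {{m^n≢0 (suc M) (suc M)}} (begin
    A * suc (suc M) ^ suc (suc M) * suc M ^ suc M   ≡⟨ lem A _ _ ⟩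
    A * suc M ^ suc M * suc (suc M) ^ suc (suc M)   ≤⟨ *-monoˡ-≤ _ ([1-1/n]^n-mono s d) ⟩
    B * M ^ suc M * suc (suc M) ^ suc (suc M)       ≡⟨ *-assoc B _ _ ⟩
    B * (M ^ suc M * suc (suc M) ^ suc (suc M))     ≤⟨ *-monoʳ-≤ B ([1-1/n]^n-step M) ⟩
    B * (suc M ^ suc M * suc M ^ suc (suc M))       ≡⟨ lem₂ B _ _ ⟩
    B * suc M ^ suc (suc M) * suc M ^ suc M         ∎)
    where
    open ≤-Reasoning
    M = d + s
    A = s ^ suc s
    B = suc s ^ suc s
    lem : ∀ a b c → a * b * c ≡ a * c * b
    lem = solve-∀
    lem₂ : ∀ a b c → a * (b * c) ≡ a * c * b
    lem₂ = solve-∀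

  -- Monotonicity settles r = M + 1, and a smaller exponent only raises (M/(M+1))^r. Applied with M
  -- + 1 the size of a list and r the number of its losses.
  [1-1/n]^r-bound : ∀ {s M r} → s ≤ M → r ≤ suc M → s ^ suc s * suc M ^ r ≤ suc s ^ suc s * M ^ r
  [1-1/n]^r-bound {s} {M} {r} s≤M r≤ = *-cancelʳ-≤ _ _ (suc M ^ e) {{m^n≢0 (suc M) e}} (begin
    A * suc M ^ r * suc M ^ e    ≡⟨ *-assoc A _ _ ⟩
    A * (suc M ^ r * suc M ^ e)  ≡⟨ cong (A *_) (^-distribˡ-+-* (suc M) r e) ⟨
    A * suc M ^ (r + e)          ≡⟨ cong (λ z → A * suc M ^ z) (m+[n∸m]≡n r≤) ⟩
    A * suc M ^ suc M            ≤⟨ subst (λ z → A * suc z ^ suc z ≤ B * z ^ suc z) (m∸n+n≡m s≤M) ([1-1/n]^n-mono s (M ∸ s)) ⟩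
    B * M ^ suc M                ≡⟨ cong (λ z → B * M ^ z) (m+[n∸m]≡n r≤) ⟨
    B * M ^ (r + e)              ≡⟨ cong (B *_) (^-distribˡ-+-* M r e) ⟩
    B * (M ^ r * M ^ e)          ≡⟨ *-assoc B _ _ ⟨
    B * M ^ r * M ^ e            ≤⟨ *-monoʳ-≤ (B * M ^ r) (^-monoˡ-≤ e (n≤1+n M)) ⟩
    B * M ^ r * suc M ^ e        ∎)
    where
    open ≤-Reasoning
    e = suc M ∸ r
    A = s ^ suc s
    B = suc s ^ suc s

  -- Finite sums and products over lists

  private
    variable
      A B : Set

  ∑ ∏ : List A → (A → ℕ) → ℕ
  ∑ xs f = sum (map f xs)
  ∏ xs f = product (map f xs)

  ∑-cong : ∀ (xs : List A) {f g : A → ℕ} → (∀ x → f x ≡ g x) → ∑ xs f ≡ ∑ xs g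
  ∑-cong xs eq = cong sum (map-cong eq xs)

  ∏-cong-∈ : ∀ (xs : List A) {f g : A → ℕ} → (∀ {x} → x ∈ xs → f x ≡ g x) → ∏ xs f ≡ ∏ xs g
  ∏-cong-∈ []       eq = refl
  ∏-cong-∈ (x ∷ xs) eq = cong₂ _*_ (eq (here refl)) (∏-cong-∈ xs (eq ∘ there))

  ∑-mono : ∀ (xs : List A) {f g : A → ℕ} → (∀ {x} → x ∈ xs → f x ≤ g x) → ∑ xs f ≤ ∑ xs g
  ∑-mono []       le = z≤n
  ∑-mono (x ∷ xs) le = +-mono-≤ (le (here refl)) (∑-mono xs (le ∘ there))

  ∑-zero : ∀ (xs : List A) → ∑ xs (λ _ → 0) ≡ 0
  ∑-zero []       = refl
  ∑-zero (x ∷ xs) = ∑-zero xs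

  ∑-distrib-+ : ∀ (xs : List A) (f g : A → ℕ) → ∑ xs (λ x → f x + g x) ≡ ∑ xs f + ∑ xs g
  ∑-distrib-+ []       f g = refl
  ∑-distrib-+ (x ∷ xs) f g = trans (cong (f x + g x +_) (∑-distrib-+ xs f g)) (lem (f x) (g x) (∑ xs f) (∑ xs g))
    where
    lem : ∀ a b c d → a + b + (c + d) ≡ a + c + (b + d)
    lem = solve-∀

  ∑-distribˡ-* : ∀ c (xs : List A) (f : A → ℕ) → ∑ xs (λ x → c * f x) ≡ c * ∑ xs f
  ∑-distribˡ-* c []       f = sym (*-zeroʳ c)
  ∑-distribˡ-* c (x ∷ xs) f = trans (cong (c * f x +_) (∑-distribˡ-* c xs f)) (sym (*-distribˡ-+ c (f x) _))

  ∑-comm : ∀ (xs : List A) (ys : List B) (f : A → B → ℕ) →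
           ∑ xs (λ x → ∑ ys (f x)) ≡ ∑ ys (λ y → ∑ xs (λ x → f x y))
  ∑-comm []       ys f = sym (∑-zero ys)
  ∑-comm (x ∷ xs) ys f = trans (cong (∑ ys (f x) +_) (∑-comm xs ys f))
                               (sym (∑-distrib-+ ys (f x) (λ y → ∑ xs (λ x → f x y))))

  ∑-bound : ∀ (xs : List A) {f : A → ℕ} {c} → (∀ {x} → x ∈ xs → f x ≤ c) → ∑ xs f ≤ length xs * c
  ∑-bound []       le = z≤n
  ∑-bound (x ∷ xs) le = +-mono-≤ (le (here refl)) (∑-bound xs (le ∘ there))

  ∑-filter-≤ : ∀ {P : A → Set} (P? : ∀ x → Dec (P x)) xs (f : A → ℕ) → ∑ (filter P? xs) f ≤ ∑ xs f
  ∑-filter-≤ P? []       f = z≤n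
  ∑-filter-≤ P? (x ∷ xs) f with P? x
  ... | yes _ = +-monoʳ-≤ (f x) (∑-filter-≤ P? xs f)
  ... | no  _ = ≤-trans (∑-filter-≤ P? xs f) (m≤n+m _ (f x))

  ∏-distrib-* : ∀ (xs : List A) (f g : A → ℕ) → ∏ xs (λ x → f x * g x) ≡ ∏ xs f * ∏ xs g
  ∏-distrib-* []       f g = refl
  ∏-distrib-* (x ∷ xs) f g = trans (cong (f x * g x *_) (∏-distrib-* xs f g)) (lem (f x) (g x) (∏ xs f) (∏ xs g))
    where
    lem : ∀ a b c d → a * b * (c * d) ≡ a * c * (b * d)
    lem = solve-∀

  ∏-const : ∀ (xs : List A) c → ∏ xs (λ _ → c) ≡ c ^ length xs
  ∏-const []       c = refl
  ∏-const (x ∷ xs) c = cong (c *_) (∏-const xs c)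

  ∏-comm : ∀ (xs : List A) (ys : List B) (f : A → B → ℕ) →
           ∏ xs (λ x → ∏ ys (f x)) ≡ ∏ ys (λ y → ∏ xs (λ x → f x y))
  ∏-comm []       ys f = sym (trans (∏-const ys 1) (^-zeroˡ (length ys)))
  ∏-comm (x ∷ xs) ys f = trans (cong (∏ ys (f x) *_) (∏-comm xs ys f))
                               (sym (∏-distrib-* ys (f x) (λ y → ∏ xs (λ x → f x y))))

  ∏-^ : ∀ (xs : List A) (f : A → ℕ) n → ∏ xs (λ x → f x ^ n) ≡ ∏ xs f ^ n
  ∏-^ []       f n = sym (^-zeroˡ n)
  ∏-^ (x ∷ xs) f n = trans (cong (f x ^ n *_) (∏-^ xs f n)) (sym (^-distrib-* (f x) (∏ xs f) n))

  ∏-mono-scaled : ∀ (xs : List A) {f g : A → ℕ} {c d} → (∀ {x} → x ∈ xs → c * f x ≤ d * g x) →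
                  c ^ length xs * ∏ xs f ≤ d ^ length xs * ∏ xs g
  ∏-mono-scaled []       le = ≤-refl
  ∏-mono-scaled (x ∷ xs) {f} {g} {c} {d} le = begin
    c * c ^ length xs * (f x * ∏ xs f)    ≡⟨ lem c (c ^ length xs) (f x) (∏ xs f) ⟩
    c * f x * (c ^ length xs * ∏ xs f)    ≤⟨ *-mono-≤ (le (here refl)) (∏-mono-scaled xs (le ∘ there)) ⟩
    d * g x * (d ^ length xs * ∏ xs g)    ≡⟨ lem d (d ^ length xs) (g x) (∏ xs g) ⟨
    d * d ^ length xs * (g x * ∏ xs g)    ∎
    where
    open ≤-Reasoning
    lem : ∀ a b c d → a * b * (c * d) ≡ a * c * (b * d)
    lem = solve-∀

  ∑-am-gm : ∀ (xs : List A) (f : A → ℕ) → length xs ^ length xs * ∏ xs f ≤ ∑ xs f ^ length xs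
  ∑-am-gm xs f = subst (λ k → k ^ k * ∏ xs f ≤ ∑ xs f ^ k) (length-map f xs) (am-gm (map f xs))

  ^-cancelʳ-≤ : ∀ n .{{_ : NonZero n}} {a b} → a ^ n ≤ b ^ n → a ≤ b
  ^-cancelʳ-≤ n {a} {b} le with a ≤? b
  ... | yes a≤b = a≤b
  ... | no  a≰b = contradiction le (<⇒≱ (^-monoˡ-< n (≰⇒> a≰b)))

  -- Markov's bound for integer weights: a nonzero `w x` is at least 1.
  length-filter-zeros : ∀ (xs : List A) (w : A → ℕ) → length xs ≤ length (filter (λ x → w x ≟ 0) xs) + ∑ xs w
  length-filter-zeros []       w = z≤n
  length-filter-zeros (x ∷ xs) w with w x
  ... | zero  = s≤s (length-filter-zeros xs w)
  ... | suc n = begin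
    1 + length xs                  ≤⟨ +-mono-≤ (s≤s (z≤n {n})) (length-filter-zeros xs w) ⟩
    suc n + (k + ∑ xs w)           ≡⟨ lem (suc n) k (∑ xs w) ⟩
    k + (suc n + ∑ xs w)           ∎
    where
    open ≤-Reasoning
    k = length (filter (λ x → w x ≟ 0) xs)
    lem : ∀ a b c → a + (b + c) ≡ b + (a + c)
    lem = solve-∀

  ∑≡0⇒≡0 : ∀ {xs : List A} {f : A → ℕ} → ∑ xs f ≡ 0 → ∀ {x} → x ∈ xs → f x ≡ 0
  ∑≡0⇒≡0 {f = f} eq (here refl) = m+n≡0⇒m≡0 (f _) eq
  ∑≡0⇒≡0 {xs = y ∷ _} {f} eq (there x∈) = ∑≡0⇒≡0 (m+n≡0⇒n≡0 (f y) eq) x∈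

  -- ∏ (L − b) = L^{N−r} (L − 1)^r for b ∈ {0,1} and r = ∑ b, with the powers moved so that no subtraction occurs.
  ∏-decremented : ∀ (xs : List A) {m b : A → ℕ} {l} → (∀ x → m x + b x ≡ suc l) → (∀ x → b x ≤ 1) →
                  suc l ^ ∑ xs b * ∏ xs m ≡ suc l ^ length xs * l ^ ∑ xs b
  ∏-decremented []       eq b≤1 = refl
  ∏-decremented (x ∷ xs) {m} {b} {l} eq b≤1 with b x | eq x | b≤1 x
  ... | 0 | eqx | _ = begin
    suc l ^ ∑ xs b * (m x * ∏ xs m)         ≡⟨ lem (suc l ^ ∑ xs b) (m x) (∏ xs m) ⟩
    m x * (suc l ^ ∑ xs b * ∏ xs m)         ≡⟨ cong₂ _*_ (trans (sym (+-identityʳ (m x))) eqx) (∏-decremented xs eq b≤1) ⟩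
    suc l * (suc l ^ length xs * l ^ ∑ xs b) ≡⟨ *-assoc (suc l) (suc l ^ length xs) _ ⟨
    suc l * suc l ^ length xs * l ^ ∑ xs b  ∎
    where
    open ≡-Reasoning
    lem : ∀ a b c → a * (b * c) ≡ b * (a * c)
    lem = solve-∀
  ... | 1 | eqx | _ = begin
    suc l * suc l ^ ∑ xs b * (m x * ∏ xs m)     ≡⟨ lem (suc l) (suc l ^ ∑ xs b) (m x) (∏ xs m) ⟩
    suc l * m x * (suc l ^ ∑ xs b * ∏ xs m)     ≡⟨ cong₂ (λ p q → suc l * p * q) (suc-injective (trans (+-comm 1 (m x)) eqx)) (∏-decremented xs eq b≤1) ⟩
    suc l * l * (suc l ^ length xs * l ^ ∑ xs b) ≡⟨ lem (suc l) l (suc l ^ length xs) (l ^ ∑ xs b) ⟩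
    suc l * suc l ^ length xs * (l * l ^ ∑ xs b) ∎
    where
    open ≡-Reasoning
    lem : ∀ a b c d → a * b * (c * d) ≡ a * c * (b * d)
    lem = solve-∀
  ... | suc (suc _) | _ | s≤s ()

  -- The estimate for one fixed coloring outside the neighbourhood

  ⟦_<_⟧ : ℕ → ℕ → ℕ
  ⟦ m < n ⟧ = if m <ᵇ n then 1 else 0

  ⟦<⟧-cases : ∀ m n → (m < n × ⟦ m < n ⟧ ≡ 1) ⊎ (n ≤ m × ⟦ m < n ⟧ ≡ 0)
  ⟦<⟧-cases m n with m <ᵇ n | <ᵇ-reflects-< m n
  ... | true  | ofʸ m<n = inj₁ (m<n , refl)
  ... | false | ofⁿ m≮n = inj₂ (≮⇒≥ m≮n , refl)

  -- bs are the neighbours of the vertex being colored and cs its colors; L u is the number of colors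
  -- available at u, m u i the number left once color i is chosen, and b u i ∈ {0,1} what i removes.
  -- A neighbour u with L u < t is "small": there the factor m u i = L u − b u i may drop to 0.
  module _ {s Δ k θ ℓ y : ℕ} .{{_ : NonZero ℓ}} .{{_ : NonZero y}}
    (many-colors : 2 * ℓ * y + suc s * θ ≤ k)
    (growth      : suc s ^ (suc s * Δ) ≤ y ^ (k ∸ suc s * θ) * s ^ (suc s * Δ))
    (bs : List A) (cs : List B) (L : A → ℕ) (m b : A → B → ℕ)
    (|bs|≤Δ : length bs ≤ Δ)
    (|cs|≡k : length cs ≡ k)
    (m+b≡L  : ∀ u i → m u i + b u i ≡ L u)
    (b≤1    : ∀ {u} → u ∈ bs → ∀ i → b u i ≤ 1)
    (∑b≤L   : ∀ {u} → u ∈ bs → ∑ cs (b u) ≤ L u)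
    where

    private
      t = suc s
      P = ∏ bs L
      c = s ^ t
      d = t ^ t

      c≤d : c ≤ d
      c≤d = ^-monoˡ-≤ t (n≤1+n s)

      -- The number of small neighbours that lose a color to i; at most tθ colors have w i ≠ 0.
      w : B → ℕ
      w i = ∑ bs (λ u → ⟦ L u < t ⟧ * b u i)

      good : List B
      good = filter (λ i → w i ≟ 0) cs

      K = length good

      ∑w≤ : ∑ cs w ≤ ∑ bs (λ u → ⟦ L u < t ⟧) * t
      ∑w≤ = begin
        ∑ cs w                                                   ≡⟨ ∑-comm cs bs (λ i u → ⟦ L u < t ⟧ * b u i) ⟩
        ∑ bs (λ u → ∑ cs (λ i → ⟦ L u < t ⟧ * b u i))            ≡⟨ ∑-cong bs (λ u → ∑-distribˡ-* ⟦ L u < t ⟧ cs (b u)) ⟩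
        ∑ bs (λ u → ⟦ L u < t ⟧ * ∑ cs (b u))                    ≤⟨ ∑-mono bs step ⟩
        ∑ bs (λ u → t * ⟦ L u < t ⟧)                             ≡⟨ ∑-distribˡ-* t bs _ ⟩
        t * ∑ bs (λ u → ⟦ L u < t ⟧)                             ≡⟨ *-comm t _ ⟩
        ∑ bs (λ u → ⟦ L u < t ⟧) * t                             ∎
        where
        open ≤-Reasoning
        step : ∀ {u} → u ∈ bs → ⟦ L u < t ⟧ * ∑ cs (b u) ≤ t * ⟦ L u < t ⟧
        step {u} u∈ with ⟦<⟧-cases (L u) t
        ... | inj₁ (L<t , eq) rewrite eq = subst₂ _≤_ (sym (*-identityˡ _)) (sym (*-identityʳ t)) (≤-trans (∑b≤L u∈) (<⇒≤ L<t))
        ... | inj₂ (_   , eq) rewrite eq = z≤n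

      -- A small neighbour loses nothing to a good color. A large one loses r ≤ ∑ b ≤ L in all, so
      -- its product is L^K (1 - 1/L)^r, where (1 - 1/L)^r ≥ c/d.
      vertex-bound : ∀ {u} → u ∈ bs → c * L u ^ K ≤ d * ∏ good (m u)
      vertex-bound {u} u∈ with ⟦<⟧-cases (L u) t
      ... | inj₁ (_ , eq) = begin
        c * L u ^ K          ≤⟨ *-monoˡ-≤ (L u ^ K) c≤d ⟩
        d * L u ^ K          ≡⟨ cong (d *_) (∏-const good (L u)) ⟨
        d * ∏ good (λ _ → L u) ≡⟨ cong (d *_) (∏-cong-∈ good unhit) ⟨
        d * ∏ good (m u)     ∎
        where
        open ≤-Reasoning
        unhit : ∀ {i} → i ∈ good → m u i ≡ L u
        unhit {i} i∈ = trans (sym (+-identityʳ (m u i))) (trans (cong (m u i +_) (sym bui≡0)) (m+b≡L u i))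
          where
          bui≡0 : b u i ≡ 0
          bui≡0 = trans (sym (*-identityˡ (b u i)))
            (subst (λ z → z * b u i ≡ 0) eq
              (∑≡0⇒≡0 {f = λ u → ⟦ L u < t ⟧ * b u i} (proj₂ (∈-filter⁻ (λ i → w i ≟ 0) {xs = cs} i∈)) u∈))
      ... | inj₂ (t≤L , _) with L u | t≤L | m+b≡L u | ∑b≤L u∈
      ...   | suc l | s≤s s≤l | m+b≡ | ∑b≤ = *-cancelʳ-≤ _ _ (suc l ^ r) {{m^n≢0 (suc l) r}} (begin
        c * suc l ^ K * suc l ^ r      ≡⟨ lem c _ _ ⟩
        c * suc l ^ r * suc l ^ K      ≤⟨ *-monoˡ-≤ (suc l ^ K) ([1-1/n]^r-bound s≤l (≤-trans (∑-filter-≤ _ cs (b u)) ∑b≤)) ⟩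
        d * l ^ r * suc l ^ K          ≡⟨ lem₂ d _ _ ⟩
        d * (suc l ^ K * l ^ r)        ≡⟨ cong (d *_) (∏-decremented good m+b≡ (b≤1 u∈)) ⟨
        d * (suc l ^ r * ∏ good (m u)) ≡⟨ lem₂ d _ _ ⟨
        d * ∏ good (m u) * suc l ^ r   ∎)
        where
        open ≤-Reasoning
        r = ∑ good (b u)
        lem : ∀ a b c → a * b * c ≡ a * c * b
        lem = solve-∀
        lem₂ : ∀ a b c → a * b * c ≡ a * (c * b)
        lem₂ = solve-∀

      -- Missing neighbours are padded by c^e ≤ d^e, which gives the same exponent Δ for every
      -- degree.
      product-bound : c ^ Δ * P ^ K ≤ d ^ Δ * ∏ good (λ i → ∏ bs (λ u → m u i))
      product-bound = begin
        c ^ Δ * P ^ K                      ≡⟨ cong (λ z → c ^ z * P ^ K) (m+[n∸m]≡n |bs|≤Δ) ⟨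
        c ^ (|bs| + e) * P ^ K             ≡⟨ cong₂ _*_ (^-distribˡ-+-* c |bs| e) (sym (∏-^ bs L K)) ⟩
        c ^ |bs| * c ^ e * ∏ bs (λ u → L u ^ K)  ≡⟨ lem (c ^ |bs|) (c ^ e) _ ⟩
        c ^ e * (c ^ |bs| * ∏ bs (λ u → L u ^ K)) ≤⟨ *-mono-≤ (^-monoˡ-≤ e c≤d) (∏-mono-scaled bs {c = c} {d} vertex-bound) ⟩
        d ^ e * (d ^ |bs| * ∏ bs (λ u → ∏ good (m u))) ≡⟨ lem (d ^ |bs|) (d ^ e) _ ⟨
        d ^ |bs| * d ^ e * ∏ bs (λ u → ∏ good (m u)) ≡⟨ cong₂ _*_ (sym (^-distribˡ-+-* d |bs| e)) (∏-comm bs good m) ⟩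
        d ^ (|bs| + e) * ∏ good (λ i → ∏ bs (λ u → m u i)) ≡⟨ cong (λ z → d ^ z * ∏ good (λ i → ∏ bs (λ u → m u i))) (m+[n∸m]≡n |bs|≤Δ) ⟩
        d ^ Δ * ∏ good (λ i → ∏ bs (λ u → m u i)) ∎
        where
        open ≤-Reasoning
        |bs| = length bs
        e = Δ ∸ length bs
        lem : ∀ a b c → a * b * c ≡ b * (a * c)
        lem = solve-∀

      -- AM-GM over the good colors, compared through K-th powers: the mean of `x` is at least
      -- (c/d)^(Δ/K) P, `growth` makes this at least P/y, and K ≥ k - tθ ≥ 2ℓy.
      few-small : ∑ bs (λ u → ⟦ L u < t ⟧) ≤ θ → 2 * ℓ * P ≤ ∑ cs (λ i → ∏ bs (λ u → m u i))
      few-small small≤θ = ≤-trans (^-cancelʳ-≤ K {{K≢0}} (*-cancelˡ-≤ (d ^ Δ) {{m^n≢0 d Δ {{m^n≢0 t t}}}} main)) (∑-filter-≤ _ cs x)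
        where
        open ≤-Reasoning
        x : B → ℕ
        x i = ∏ bs (λ u → m u i)

        k≤K+tθ : k ≤ K + t * θ
        k≤K+tθ = begin
          k                    ≡⟨ |cs|≡k ⟨
          length cs            ≤⟨ length-filter-zeros cs w ⟩
          K + ∑ cs w           ≤⟨ +-monoʳ-≤ K (≤-trans ∑w≤ (*-monoˡ-≤ t small≤θ)) ⟩
          K + θ * t            ≡⟨ cong (K +_) (*-comm θ t) ⟩
          K + t * θ            ∎

        2ℓy≤K : 2 * ℓ * y ≤ K
        2ℓy≤K = +-cancelʳ-≤ (t * θ) _ _ (≤-trans many-colors k≤K+tθ)

        K≢0 : NonZero K
        K≢0 = >-nonZero (<-≤-trans (>-nonZero⁻¹ _ {{m*n≢0 (2 * ℓ) y {{m*n≢0 2 ℓ}}}}) 2ℓy≤K)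

        k∸tθ≤K : k ∸ t * θ ≤ K
        k∸tθ≤K = m≤n+o⇒m∸n≤o k (t * θ) (≤-trans k≤K+tθ (≤-reflexive (+-comm K _)))

        growth′ : d ^ Δ ≤ y ^ K * c ^ Δ
        growth′ = begin
          d ^ Δ                              ≡⟨ ^-*-assoc t t Δ ⟩
          t ^ (t * Δ)                        ≤⟨ growth ⟩
          y ^ (k ∸ t * θ) * s ^ (t * Δ)      ≤⟨ *-monoˡ-≤ _ (^-monoʳ-≤ y k∸tθ≤K) ⟩
          y ^ K * s ^ (t * Δ)                ≡⟨ cong (y ^ K *_) (^-*-assoc s t Δ) ⟨
          y ^ K * c ^ Δ                      ∎

        lem : ∀ a b c d → a * c * (b * d) ≡ a * b * (c * d)
        lem = solve-∀
        lem₂ : ∀ a b c → a * (b * c) ≡ b * (a * c)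
        lem₂ = solve-∀

        main : d ^ Δ * (2 * ℓ * P) ^ K ≤ d ^ Δ * ∑ good x ^ K
        main = begin
          d ^ Δ * (2 * ℓ * P) ^ K                        ≤⟨ *-monoˡ-≤ _ growth′ ⟩
          y ^ K * c ^ Δ * (2 * ℓ * P) ^ K                ≡⟨ cong (y ^ K * c ^ Δ *_) (^-distrib-* (2 * ℓ) P K) ⟩
          y ^ K * c ^ Δ * ((2 * ℓ) ^ K * P ^ K)          ≡⟨ lem (y ^ K) ((2 * ℓ) ^ K) (c ^ Δ) (P ^ K) ⟩
          y ^ K * (2 * ℓ) ^ K * (c ^ Δ * P ^ K)          ≡⟨ cong (_* (c ^ Δ * P ^ K)) (trans (*-comm (y ^ K) _) (sym (^-distrib-* (2 * ℓ) y K))) ⟩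
          (2 * ℓ * y) ^ K * (c ^ Δ * P ^ K)              ≤⟨ *-mono-≤ (^-monoˡ-≤ K 2ℓy≤K) product-bound ⟩
          K ^ K * (d ^ Δ * ∏ good x)                     ≡⟨ lem₂ (K ^ K) (d ^ Δ) _ ⟩
          d ^ Δ * (K ^ K * ∏ good x)                     ≤⟨ *-monoʳ-≤ (d ^ Δ) (∑-am-gm good x) ⟩
          d ^ Δ * ∑ good x ^ K                           ∎

    -- If at most θ neighbours are small, `few-small` applies; otherwise the last term alone reaches
    -- 2ℓθP. Merging the cases into one linear inequality is what permits summation over colorings.
    expected-availability :
      2 * ℓ * θ * ∏ bs L ≤
      θ * ∑ cs (λ i → ∏ bs (λ u → m u i)) + 2 * ℓ * ∑ bs (λ u → ⟦ L u < suc s ⟧ * ∏ bs L)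
    expected-availability = begin
      2 * ℓ * θ * P                              ≤⟨ cases (≤-total (∑ bs (λ u → ⟦ L u < t ⟧)) θ) ⟩
      θ * X + 2 * ℓ * (P * ∑ bs (λ u → ⟦ L u < t ⟧)) ≡⟨ cong (λ z → θ * X + 2 * ℓ * z) (∑-distribˡ-* P bs _) ⟨
      θ * X + 2 * ℓ * ∑ bs (λ u → P * ⟦ L u < t ⟧)   ≡⟨ cong (λ z → θ * X + 2 * ℓ * z) (∑-cong bs (λ u → *-comm P _)) ⟩
      θ * X + 2 * ℓ * ∑ bs (λ u → ⟦ L u < t ⟧ * P)   ∎
      where
      open ≤-Reasoning
      X = ∑ cs (λ i → ∏ bs (λ u → m u i))
      S = ∑ bs (λ u → ⟦ L u < t ⟧)
      lem : ∀ a θ P → a * θ * P ≡ θ * (a * P)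
      lem = solve-∀
      lem₂ : ∀ a θ P → a * θ * P ≡ a * (P * θ)
      lem₂ = solve-∀
      cases : S ≤ θ ⊎ θ ≤ S → 2 * ℓ * θ * P ≤ θ * X + 2 * ℓ * (P * S)
      cases (inj₁ S≤θ) = ≤-trans (≤-trans (≤-reflexive (lem (2 * ℓ) θ P)) (*-monoʳ-≤ θ (few-small S≤θ))) (m≤m+n _ _)
      cases (inj₂ θ≤S) = ≤-trans (≤-trans (≤-reflexive (lem₂ (2 * ℓ) θ P)) (*-monoʳ-≤ (2 * ℓ) (*-monoʳ-≤ P θ≤S))) (m≤n+m _ (θ * X))

-- Counting colorings of a cover

module Colorings where

  open Inequalities
  open import Data.Bool using (Bool; true; false; if_then_else_)
  open import Data.Bool.Properties using (T?; ¬-not; T-≡)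
  open import Data.Fin using (Fin)
  import Data.Fin.Properties as Fin
  open import Data.List using (List; []; _∷_; _++_; length; filter; allFin)
  open import Data.List.Membership.Propositional using (_∈_)
  open import Data.List.Membership.Propositional.Properties
    using (∈-filter⁻; ∈-filter⁺; ∈-allFin; ∈-∃++; ∈-++⁻; ∈-++⁺ˡ; ∈-++⁺ʳ)
  open import Data.List.Properties using (length-tabulate)
  open import Data.List.Relation.Binary.Permutation.Propositional
    using (_↭_; refl; prep; swap; trans; ↭-sym; ↭-trans; ↭⇒↭ₛ)
  open import Data.List.Relation.Binary.Permutation.Propositional.Properties
    using (shift; ++⁺ˡ; ↭-length; ∈-resp-↭; ¬x∷xs↭[])
  open import Data.List.Relation.Binary.Permutation.Setoid.Properties using (Unique-resp-↭)
  open import Data.List.Relation.Unary.All as All using (All)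
  open import Data.List.Relation.Unary.AllPairs using ([]; _∷_)
  open import Data.List.Relation.Unary.Any using (here; there)
  open import Data.List.Relation.Unary.Unique.Propositional as Unique using (Unique)
  open import Data.List.Relation.Unary.Unique.Propositional.Properties using (filter⁺; allFin⁺)
  open import Data.Nat
  open import Data.Nat.Properties
  open import Data.Nat.Tactic.RingSolver using (solve-∀)
  open import Data.Product using (_,_; proj₁; proj₂; ∃; _×_)
  open import Data.Sum using (inj₁; inj₂)
  open import Data.Unit using (⊤)
  open import Data.Vec.Functional using (updateAt)
  open import Data.Vec.Functional.Properties using (updateAt-updates; updateAt-minimal)
  open import Function using (_∘_; const)
  open import Function.Bundles using (Equivalence)
  open import Relation.Binary.PropositionalEquality as ≡
    using (_≡_; _≢_; sym; cong; cong₂; subst; setoid) renaming (refl to ≡-refl; trans to ≡-trans)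
  open import Relation.Nullary using (Dec; yes; no; ¬?; contradiction)

  private
    variable
      A : Set

  Unique-↭ : ∀ {xs ys : List A} → xs ↭ ys → Unique xs → Unique ys
  Unique-↭ p = Unique-resp-↭ (setoid _) (↭⇒↭ₛ p)

  length-⊆ : ∀ {xs ys : List A} → Unique xs → (∀ {x} → x ∈ xs → x ∈ ys) → length xs ≤ length ys
  length-⊆ []            sub = z≤n
  length-⊆ {xs = x ∷ xs} (x∉ ∷ uniq) sub with as , bs , ≡-refl ← ∈-∃++ (sub (here ≡-refl)) = begin
    suc (length xs)            ≤⟨ s≤s (length-⊆ uniq sub′) ⟩
    suc (length (as ++ bs))    ≡⟨ ↭-length (shift x as bs) ⟨
    length (as ++ x ∷ bs)      ∎
    where
    open ≤-Reasoning
    sub′ : ∀ {y} → y ∈ xs → y ∈ as ++ bs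
    sub′ y∈ with ∈-++⁻ as (sub (there y∈))
    ... | inj₁ y∈as          = ∈-++⁺ˡ y∈as
    ... | inj₂ (here ≡-refl) = contradiction ≡-refl (All.lookup x∉ y∈)
    ... | inj₂ (there y∈bs)  = ∈-++⁺ʳ as y∈bs

  ∈⇒↭ : ∀ {x : A} {xs} → x ∈ xs → ∃ λ ys → xs ↭ x ∷ ys
  ∈⇒↭ {x = x} x∈ with as , bs , ≡-refl ← ∈-∃++ x∈ = as ++ bs , shift x as bs

  filter-split-↭ : ∀ {P : A → Set} (P? : ∀ x → Dec (P x)) xs → xs ↭ filter (¬? ∘ P?) xs ++ filter P? xs
  filter-split-↭ P? []       = refl
  filter-split-↭ P? (x ∷ xs) with P? x
  ... | yes _ = ↭-trans (prep x (filter-split-↭ P? xs)) (↭-sym (shift x (filter (¬? ∘ P?) xs) _))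
  ... | no  _ = prep x (filter-split-↭ P? xs)

  ∑-positive : ∀ (xs : List A) {f : A → ℕ} → 0 < ∑ xs f → ∃ λ x → 0 < f x
  ∑-positive (x ∷ xs) {f} pos with f x in eq
  ... | suc n = x , subst (0 <_) (sym eq) z<s
  ... | zero  = ∑-positive xs pos

  *-positive : ∀ {a b} → 0 < a * b → 0 < a × 0 < b
  *-positive {suc a} {suc b} _   = z<s , z<s
  *-positive {suc a} {zero}  pos = contradiction (subst (0 <_) (*-zeroʳ a) pos) λ ()

  ∑-indicator-≤1 : ∀ {xs : List A} → Unique xs → (p : A → Bool) →
                   (∀ {x y} → p x ≡ true → p y ≡ true → x ≡ y) → ∑ xs (λ x → if p x then 1 else 0) ≤ 1
  ∑-indicator-≤1 []                      p inj = z≤n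
  ∑-indicator-≤1 {xs = x ∷ xs} (x∉ ∷ uniq) p inj with p x in eq
  ... | false = ∑-indicator-≤1 uniq p inj
  ... | true  = s≤s (≤-trans (∑-mono xs vanish) (≤-reflexive (∑-zero xs)))
    where
    vanish : ∀ {y} → y ∈ xs → (if p y then 1 else 0) ≤ 0
    vanish {y} y∈ with p y in eq′
    ... | false = z≤n
    ... | true  = contradiction (inj eq eq′) (All.lookup x∉ y∈)

  module Counting {n k} {G : Graph n} (C : Cover G k) where

    -- The availability of colors under a partial coloring: 1 or 0, as a number so that counts of
    -- extensions are semiring expressions.
    State : Set
    State = Fin n → Fin k → ℕ

    hit free : Fin n → Fin k → Fin n → Fin k → ℕ
    hit  u j v i = if hadj C u j v i then 1 else 0
    free u j v i = if hadj C u j v i then 0 else 1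

    free+hit≡1 : ∀ u j v i → free u j v i + hit u j v i ≡ 1
    free+hit≡1 u j v i with hadj C u j v i
    ... | true  = ≡-refl
    ... | false = ≡-refl

    free≤1 : ∀ u j v i → free u j v i ≤ 1
    free≤1 u j v i = subst (free u j v i ≤_) (free+hit≡1 u j v i) (m≤m+n _ _)

    free-sym : ∀ u j v i → free u j v i ≡ free v i u j
    free-sym u j v i = cong (λ z → if z then 0 else 1) (hsymm C u j v i)

    free-nonadjacent : ∀ {u v} → u ≢ v → adj G u v ≡ false → ∀ j i → free u j v i ≡ 1
    free-nonadjacent {u} {v} u≢v ¬adj j i with hadj C u j v i in eq
    ... | false = ≡-refl
    ... | true  = contradiction (≡-trans (sym (respect C u j v i u≢v eq)) ¬adj) λ ()

    free-positive : ∀ {u j v i} → 0 < free u j v i → hadj C u j v i ≡ false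
    free-positive {u} {j} {v} {i} pos with hadj C u j v i
    ... | false = ≡-refl

    colors : List (Fin k)
    colors = allFin k

    full : State
    full _ _ = 1

    assign : State → Fin n → Fin k → State
    assign φ v i u j = φ u j * free u j v i

    avail : State → Fin n → ℕ
    avail φ u = ∑ colors (φ u)

    -- An unnormalized expectation: for a 0/1 state, `F` is summed over the proper colorings of `vs`
    -- that `φ` allows, each evaluated at the state it leaves behind.
    extend : List (Fin n) → (State → ℕ) → State → ℕ
    extend []       F φ = F φ
    extend (v ∷ vs) F φ = ∑ colors (λ i → φ v i * extend vs F (assign φ v i))

    count : List (Fin n) → State → ℕ
    count vs = extend vs (λ _ → 1)

    extend-++ : ∀ us vs F φ → extend (us ++ vs) F φ ≡ extend us (extend vs F) φ
    extend-++ []       vs F φ = ≡-refl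
    extend-++ (u ∷ us) vs F φ = ∑-cong colors (λ i → cong (φ u i *_) (extend-++ us vs F _))

    extend-+ : ∀ vs F F′ φ → extend vs (λ ψ → F ψ + F′ ψ) φ ≡ extend vs F φ + extend vs F′ φ
    extend-+ []       F F′ φ = ≡-refl
    extend-+ (v ∷ vs) F F′ φ = ≡-trans
      (∑-cong colors (λ i → ≡-trans (cong (φ v i *_) (extend-+ vs F F′ _)) (*-distribˡ-+ (φ v i) _ _)))
      (∑-distrib-+ colors _ _)

    extend-* : ∀ vs c F φ → extend vs (λ ψ → c * F ψ) φ ≡ c * extend vs F φ
    extend-* []       c F φ = ≡-refl
    extend-* (v ∷ vs) c F φ = ≡-trans
      (∑-cong colors (λ i → ≡-trans (cong (φ v i *_) (extend-* vs c F _)) (lem (φ v i) c _)))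
      (∑-distribˡ-* c colors _)
      where
      lem : ∀ a b c → a * (b * c) ≡ b * (a * c)
      lem = solve-∀

    extend-zero : ∀ vs φ → extend vs (λ _ → 0) φ ≡ 0
    extend-zero vs φ = extend-* vs 0 (λ _ → 0) φ

    extend-∑ : ∀ vs (xs : List A) (F : A → State → ℕ) φ →
               extend vs (λ ψ → ∑ xs (λ x → F x ψ)) φ ≡ ∑ xs (λ x → extend vs (F x) φ)
    extend-∑ vs []       F φ = extend-zero vs φ
    extend-∑ vs (x ∷ xs) F φ = ≡-trans (extend-+ vs (F x) _ φ) (cong (extend vs (F x) φ +_) (extend-∑ vs xs F φ))

    -- The invariant `I` restricts the comparison to states that colorings of `vs` can reach; the
    -- estimate for one coloring needs the list of `v` to be intact.
    extend-mono : ∀ {I : State → Set} vs {F F′ : State → ℕ} →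
                  (∀ {φ v} → v ∈ vs → I φ → ∀ i → I (assign φ v i)) →
                  (∀ {φ} → I φ → F φ ≤ F′ φ) →
                  ∀ {φ} → I φ → extend vs F φ ≤ extend vs F′ φ
    extend-mono []       pres le inv = le inv
    extend-mono (v ∷ vs) pres le {φ} inv = ∑-mono colors (λ {i} _ →
      *-monoʳ-≤ (φ v i) (extend-mono vs (pres ∘ there) le (pres (here ≡-refl) inv i)))

    count-cong : ∀ vs {φ ψ : State} → (∀ u j → φ u j ≡ ψ u j) → count vs φ ≡ count vs ψ
    count-cong []       eq = ≡-refl
    count-cong (v ∷ vs) eq = ∑-cong colors (λ i →
      cong₂ _*_ (eq v i) (count-cong vs (λ u j → cong (_* free u j v i) (eq u j))))

    -- A transposition exchanges two sums, and symmetry of H moves the conflict test to the other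
    -- vertex. The resulting states agree only pointwise, hence `count-cong`.
    count-↭ : ∀ {vs ws} → vs ↭ ws → ∀ φ → count vs φ ≡ count ws φ
    count-↭ refl       φ = ≡-refl
    count-↭ (prep v p) φ = ∑-cong colors (λ i → cong (φ v i *_) (count-↭ p _))
    count-↭ (trans p q) φ = ≡-trans (count-↭ p φ) (count-↭ q φ)
    count-↭ (swap {vs} {ws} v w p) φ = begin
      ∑ colors (λ i → φ v i * ∑ colors (λ j → φ w j * free w j v i * count vs (φ₁ i j)))
        ≡⟨ ∑-cong colors (λ i → ∑-distribˡ-* (φ v i) colors _) ⟨
      ∑ colors (λ i → ∑ colors (λ j → φ v i * (φ w j * free w j v i * count vs (φ₁ i j))))
        ≡⟨ ∑-comm colors colors _ ⟩
      ∑ colors (λ j → ∑ colors (λ i → φ v i * (φ w j * free w j v i * count vs (φ₁ i j))))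
        ≡⟨ ∑-cong colors (λ j → ∑-cong colors (λ i → exchange i j)) ⟩
      ∑ colors (λ j → ∑ colors (λ i → φ w j * (φ v i * free v i w j * count ws (φ₂ i j))))
        ≡⟨ ∑-cong colors (λ j → ∑-distribˡ-* (φ w j) colors _) ⟩
      ∑ colors (λ j → φ w j * ∑ colors (λ i → φ v i * free v i w j * count ws (φ₂ i j)))
        ∎
      where
      open ≡.≡-Reasoning
      φ₁ φ₂ : Fin k → Fin k → State
      φ₁ i j = assign (assign φ v i) w j
      φ₂ i j = assign (assign φ w j) v i
      lem : ∀ a b c d → a * (b * c * d) ≡ b * (a * c * d)
      lem = solve-∀
      lem₂ : ∀ a b c → a * b * c ≡ a * c * b
      lem₂ = solve-∀
      exchange : ∀ i j → φ v i * (φ w j * free w j v i * count vs (φ₁ i j)) ≡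
                         φ w j * (φ v i * free v i w j * count ws (φ₂ i j))
      exchange i j = ≡-trans (lem (φ v i) (φ w j) (free w j v i) _)
        (cong (φ w j *_) (cong₂ _*_ (cong (φ v i *_) (free-sym w j v i))
          (≡-trans (count-↭ p (φ₁ i j)) (count-cong ws (λ u l → lem₂ (φ u l) _ _)))))

    count-independent : ∀ {vs} → Unique vs → (∀ {u w} → u ∈ vs → w ∈ vs → adj G u w ≡ false) →
                        ∀ φ → count vs φ ≡ ∏ vs (avail φ)
    count-independent []                        indep φ = ≡-refl
    count-independent {v ∷ vs} (v∉ ∷ uniq) indep φ = begin
      ∑ colors (λ i → φ v i * count vs (assign φ v i))
        ≡⟨ ∑-cong colors (λ i → cong (φ v i *_) (≡-trans (count-independent uniq (λ u∈ w∈ → indep (there u∈) (there w∈)) _)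
             (∏-cong-∈ vs (λ u∈ → ∑-cong colors (unchanged u∈ i))))) ⟩
      ∑ colors (λ i → φ v i * ∏ vs (avail φ))  ≡⟨ ∑-cong colors (λ i → *-comm (φ v i) _) ⟩
      ∑ colors (λ i → ∏ vs (avail φ) * φ v i)  ≡⟨ ∑-distribˡ-* (∏ vs (avail φ)) colors (φ v) ⟩
      ∏ vs (avail φ) * avail φ v               ≡⟨ *-comm _ (avail φ v) ⟩
      avail φ v * ∏ vs (avail φ)               ∎
      where
      open ≡.≡-Reasoning
      unchanged : ∀ {u} → u ∈ vs → ∀ i j → φ u j * free u j v i ≡ φ u j
      unchanged u∈ i j = ≡-trans
        (cong (φ _ j *_) (free-nonadjacent (λ eq → All.lookup v∉ u∈ (sym eq)) (indep (there u∈) (here ≡-refl)) j i))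
        (*-identityʳ _)

    -- A positive sum has a positive term, so colors are read off vertex by vertex; `i₀` fills the
    -- vertices outside the list.
    extract : Fin k → ∀ {vs} → Unique vs → ∀ φ → 0 < count vs φ → ∃ λ (f : Fin n → Fin k) →
              (∀ {u} → u ∈ vs → 0 < φ u (f u)) ×
              (∀ {u w} → u ∈ vs → w ∈ vs → u ≢ w → hadj C u (f u) w (f w) ≡ false)
    extract i₀ []                   φ pos = const i₀ , (λ ()) , (λ ())
    extract i₀ {v ∷ vs} (v∉ ∷ uniq) φ pos
      with i , pos′ ← ∑-positive colors pos
      with φvi>0 , count>0 ← *-positive {φ v i} pos′
      with f , avl , prop ← extract i₀ uniq (assign φ v i) count>0 = g , avl′ , prop′
      where
      g : Fin n → Fin k
      g = updateAt f v (const i)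
      gv : g v ≡ i
      gv = updateAt-updates v f
      v≢ : ∀ {u} → u ∈ vs → u ≢ v
      v≢ u∈ eq = All.lookup v∉ u∈ (sym eq)
      gu : ∀ {u} → u ∈ vs → g u ≡ f u
      gu {u} u∈ = updateAt-minimal u v f (v≢ u∈)
      avl′ : ∀ {u} → u ∈ v ∷ vs → 0 < φ u (g u)
      avl′ (here ≡-refl) = subst (λ z → 0 < φ v z) (sym gv) φvi>0
      avl′ {u} (there u∈) = subst (λ z → 0 < φ u z) (sym (gu u∈)) (proj₁ (*-positive {φ u (f u)} (avl u∈)))
      v-prop : ∀ {u} → u ∈ vs → hadj C u (g u) v (g v) ≡ false
      v-prop {u} u∈ = ≡.subst₂ (λ a b → hadj C u a v b ≡ false) (sym (gu u∈)) (sym gv)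
                        (free-positive (proj₂ (*-positive {φ u (f u)} (avl u∈))))
      prop′ : ∀ {u w} → u ∈ v ∷ vs → w ∈ v ∷ vs → u ≢ w → hadj C u (g u) w (g w) ≡ false
      prop′ (here ≡-refl) (here ≡-refl) u≢w = contradiction ≡-refl u≢w
      prop′ {w = w} (here ≡-refl) (there w∈) u≢w = ≡-trans (hsymm C v (g v) w (g w)) (v-prop w∈)
      prop′ (there u∈) (here ≡-refl) u≢w = v-prop u∈
      prop′ {u} {w} (there u∈) (there w∈) u≢w =
        ≡.subst₂ (λ a b → hadj C u a w b ≡ false) (sym (gu u∈)) (sym (gu w∈)) (prop u∈ w∈ u≢w)

    count-positive⇒coloring : Fin k → 0 < count (allFin n) full → CoverColoring C
    count-positive⇒coloring i₀ pos with f , _ , prop ← extract i₀ (allFin⁺ n) full pos = f , proper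
      where
      proper : ∀ u v → hadj C u (f u) v (f v) ≡ false
      proper u v with u Fin.≟ v
      ... | yes ≡-refl = hirrefl C u (f u)
      ... | no  u≢v    = prop (∈-allFin u) (∈-allFin v) u≢v

    -- The two halves of the matching condition. This one yields b ≤ 1 in `expected-availability`,
    -- its mirror image yields ∑ b ≤ L.
    ∑-hit≤1 : ∀ {u v} → u ≢ v → ∀ i → ∑ colors (λ j → hit u j v i) ≤ 1
    ∑-hit≤1 {u} {v} u≢v i = ∑-indicator-≤1 (allFin⁺ k) (λ j → hadj C u j v i)
      (λ {j} {j′} e e′ → matchR C u j j′ v i u≢v e e′)

    ∑-hit≤1′ : ∀ {u v} → u ≢ v → ∀ j → ∑ colors (λ i → hit u j v i) ≤ 1
    ∑-hit≤1′ {u} {v} u≢v j = ∑-indicator-≤1 (allFin⁺ k) (λ i → hadj C u j v i)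
      (λ {i} {i′} e e′ → matchL C u j v i i′ u≢v e e′)

    -- The counting induction

    module _ (triangle-free : TriangleFree G) {s Δ θ ℓ y : ℕ} (degree≤Δ : ∀ u → degree G u ≤ Δ)
      .{{_ : NonZero ℓ}} .{{_ : NonZero y}} .{{_ : NonZero θ}}
      (2Δt≤ℓθ      : 2 * (Δ * suc s) ≤ ℓ * θ)
      (many-colors : 2 * ℓ * y + suc s * θ ≤ k)
      (growth      : suc s ^ (suc s * Δ) ≤ y ^ (k ∸ suc s * θ) * s ^ (suc s * Δ))
      where

      private
        t = suc s

      -- With the non-neighbours of `v` colored before its neighbours, summing `pointwise` over the
      -- colorings of `as` gives 2ℓθc ≤ θc′ + 2ℓD. The induction hypothesis bounds 2ℓD by ℓθc, half
      -- of the left side.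
      count-step : ∀ {v vs} → Unique (v ∷ vs) →
                   (∀ {u ws} → vs ↭ u ∷ ws → ℓ * count ws full ≤ count (u ∷ ws) full) →
                   ℓ * count vs full ≤ count (v ∷ vs) full
      count-step {v} {vs} (v∉ ∷ uniq) IH =
        *-cancelˡ-≤ θ (+-cancelʳ-≤ (ℓ * θ * count vs full) _ _ conclusion)
        where
        open ≤-Reasoning
        N? : ∀ u → Dec _
        N? u = T? (adj G v u)
        as bs : List (Fin n)
        as = filter (¬? ∘ N?) vs
        bs = filter N? vs

        adj-bs : ∀ {u} → u ∈ bs → adj G v u ≡ true
        adj-bs u∈ = Equivalence.to T-≡ (proj₂ (∈-filter⁻ N? {xs = vs} u∈))

        adj-as : ∀ {u} → u ∈ as → adj G u v ≡ false
        adj-as {u} u∈ = ≡-trans (symm G u v) (¬-not (λ e → proj₂ (∈-filter⁻ (¬? ∘ N?) {xs = vs} u∈) (Equivalence.from T-≡ e)))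

        bs≢v : ∀ {u} → adj G v u ≡ true → u ≢ v
        bs≢v adjvu ≡-refl = contradiction (≡-trans (sym adjvu) (irrefl G v)) λ ()

        as≢v : ∀ {u} → u ∈ as → v ≢ u
        as≢v u∈ = All.lookup v∉ (proj₁ (∈-filter⁻ (¬? ∘ N?) {xs = vs} u∈))

        split : vs ↭ as ++ bs
        split = filter-split-↭ N? vs

        independent : ∀ {u w} → u ∈ bs → w ∈ bs → adj G u w ≡ false
        independent {u} {w} u∈ w∈ = ¬-not (triangle-free u v w (≡-trans (symm G u v) (adj-bs u∈)) (adj-bs w∈))

        unique-bs : Unique bs
        unique-bs = filter⁺ N? uniq

        |bs|≤Δ : length bs ≤ Δ
        |bs|≤Δ = ≤-trans (length-⊆ unique-bs
          (λ {u} u∈ → ∈-filter⁺ N? (∈-allFin u) (proj₂ (∈-filter⁻ N? {xs = vs} u∈)))) (degree≤Δ v)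

        -- What survives the coloring of non-neighbours: `v` keeps all k colors, and entries stay at
        -- most 1, so that a single conflict removes at most one color.
        Admissible : State → Set
        Admissible φ = (∀ i → φ v i ≡ 1) × (∀ u j → φ u j ≤ 1)

        admissible-assign : ∀ {φ w} → w ∈ as → Admissible φ → ∀ i → Admissible (assign φ w i)
        admissible-assign {φ} {w} w∈ (φv , φ≤1) i =
          (λ j → cong₂ _*_ (φv j) (free-nonadjacent (as≢v w∈) (≡-trans (symm G v w) (adj-as w∈)) j i)) ,
          (λ u j → *-mono-≤ (φ≤1 u j) (free≤1 u j w i))

        -- The induction hypothesis at u makes a small list at u rare: colorings with fewer than t colors
        -- available at u number at most t times those of vs − u, hence at most a fraction t/ℓ of those of vs.
        deficit : State → Fin n → ℕ
        deficit φ u = ⟦ avail φ u < t ⟧ * count bs φ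

        pointwise : ∀ {φ} → Admissible φ →
                    2 * ℓ * θ * count bs φ ≤ θ * count (v ∷ bs) φ + 2 * ℓ * ∑ bs (deficit φ)
        pointwise {φ} (φv , φ≤1) = ≡.subst₂
          (λ p q → 2 * ℓ * θ * p ≤ θ * q + 2 * ℓ * ∑ bs (λ u → ⟦ avail φ u < t ⟧ * p))
          (sym (count-bs φ)) (sym count-v∷bs)
          (expected-availability many-colors growth bs colors (avail φ) (λ u i → avail (assign φ v i) u) blocked
            |bs|≤Δ (length-tabulate (λ i → i)) avail-split blocked≤1 ∑-blocked)
          where
          count-bs : ∀ ψ → count bs ψ ≡ ∏ bs (avail ψ)
          count-bs = count-independent unique-bs independent

          blocked : Fin n → Fin k → ℕ
          blocked u i = ∑ colors (λ j → φ u j * hit u j v i)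

          count-v∷bs : count (v ∷ bs) φ ≡ ∑ colors (λ i → ∏ bs (avail (assign φ v i)))
          count-v∷bs = ∑-cong colors (λ i → ≡-trans (cong₂ _*_ (φv i) (count-bs _)) (*-identityˡ _))

          avail-split : ∀ u i → avail (assign φ v i) u + blocked u i ≡ avail φ u
          avail-split u i = ≡-trans (sym (∑-distrib-+ colors _ _)) (∑-cong colors (λ j →
            ≡-trans (sym (*-distribˡ-+ (φ u j) _ _))
              (≡-trans (cong (φ u j *_) (free+hit≡1 u j v i)) (*-identityʳ (φ u j)))))

          blocked≤1 : ∀ {u} → u ∈ bs → ∀ i → blocked u i ≤ 1
          blocked≤1 {u} u∈ i = ≤-trans
            (∑-mono colors (λ {j} _ → ≤-trans (*-monoˡ-≤ (hit u j v i) (φ≤1 u j)) (≤-reflexive (*-identityˡ _))))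
            (∑-hit≤1 (bs≢v (adj-bs u∈)) i)

          ∑-blocked : ∀ {u} → u ∈ bs → ∑ colors (blocked u) ≤ avail φ u
          ∑-blocked {u} u∈ = begin
            ∑ colors (λ i → ∑ colors (λ j → φ u j * hit u j v i)) ≡⟨ ∑-comm colors colors _ ⟩
            ∑ colors (λ j → ∑ colors (λ i → φ u j * hit u j v i)) ≡⟨ ∑-cong colors (λ j → ∑-distribˡ-* (φ u j) colors _) ⟩
            ∑ colors (λ j → φ u j * ∑ colors (λ i → hit u j v i)) ≤⟨ ∑-mono colors (λ {j} _ → *-monoʳ-≤ (φ u j) (∑-hit≤1′ (bs≢v (adj-bs u∈)) j)) ⟩
            ∑ colors (λ j → φ u j * 1)                            ≡⟨ ∑-cong colors (λ j → *-identityʳ (φ u j)) ⟩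
            avail φ u                                             ∎

        deficit-bound : ∀ {u} → u ∈ bs → ℓ * extend as (λ φ → deficit φ u) full ≤ t * count vs full
        deficit-bound {u} u∈ with bs′ , p ← ∈⇒↭ u∈ = begin
          ℓ * extend as (λ φ → deficit φ u) full          ≤⟨ *-monoʳ-≤ ℓ (extend-mono {I = λ _ → ⊤} as {F′ = λ φ → t * count bs′ φ} _ (λ {φ} _ → drop-u φ) _) ⟩
          ℓ * extend as (λ φ → t * count bs′ φ) full      ≡⟨ cong (ℓ *_) (extend-* as t (count bs′) full) ⟩
          ℓ * (t * extend as (count bs′) full)            ≡⟨ lem ℓ t _ ⟩
          t * (ℓ * extend as (count bs′) full)            ≡⟨ cong (λ z → t * (ℓ * z)) (extend-++ as bs′ (λ _ → 1) full) ⟨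
          t * (ℓ * count (as ++ bs′) full)                ≤⟨ *-monoʳ-≤ t (IH vs↭) ⟩
          t * count (u ∷ as ++ bs′) full                  ≡⟨ cong (t *_) (count-↭ vs↭ full) ⟨
          t * count vs full                               ∎
          where
          lem : ∀ a b c → a * (b * c) ≡ b * (a * c)
          lem = solve-∀
          vs↭ : vs ↭ u ∷ as ++ bs′
          vs↭ = ↭-trans split (↭-trans (++⁺ˡ as p) (shift u as bs′))
          drop-u : ∀ φ → deficit φ u ≤ t * count bs′ φ
          drop-u φ with ⟦<⟧-cases (avail φ u) t
          ... | inj₂ (_ , eq)   rewrite eq = z≤n
          ... | inj₁ (L<t , eq) rewrite eq = begin
            1 * count bs φ             ≡⟨ *-identityˡ _ ⟩
            count bs φ                 ≡⟨ count-↭ p φ ⟩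
            -- As `bs` is independent, the choices at `u` split off as a factor, which is below t
            -- here.
            count (u ∷ bs′) φ          ≡⟨ count-independent unique′ independent′ φ ⟩
            avail φ u * ∏ bs′ (avail φ) ≡⟨ cong (avail φ u *_) (count-independent (Unique.tail unique′) (λ a b → independent′ (there a) (there b)) φ) ⟨
            avail φ u * count bs′ φ    ≤⟨ *-monoˡ-≤ _ (<⇒≤ L<t) ⟩
            t * count bs′ φ            ∎
            where
            unique′ : Unique (u ∷ bs′)
            unique′ = Unique-↭ p unique-bs
            independent′ : ∀ {x w} → x ∈ u ∷ bs′ → w ∈ u ∷ bs′ → adj G x w ≡ false
            independent′ x∈ w∈ = independent (∈-resp-↭ (↭-sym p) x∈) (∈-resp-↭ (↭-sym p) w∈)

        conclusion : θ * (ℓ * count vs full) + ℓ * θ * count vs full ≤ θ * count (v ∷ vs) full + ℓ * θ * count vs full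
        conclusion = begin
          θ * (ℓ * c) + ℓ * θ * c                           ≡⟨ lem ℓ θ c ⟩
          2 * ℓ * θ * c                                     ≡⟨ cong (2 * ℓ * θ *_) (≡-trans (count-↭ split full) (extend-++ as bs _ full)) ⟩
          2 * ℓ * θ * extend as (count bs) full             ≡⟨ extend-* as (2 * ℓ * θ) (count bs) full ⟨
          extend as (λ φ → 2 * ℓ * θ * count bs φ) full     ≤⟨ extend-mono as admissible-assign pointwise ((λ _ → ≡-refl) , (λ _ _ → ≤-refl)) ⟩
          extend as (λ φ → θ * count (v ∷ bs) φ + 2 * ℓ * ∑ bs (deficit φ)) full
            ≡⟨ extend-+ as _ _ full ⟩
          extend as (λ φ → θ * count (v ∷ bs) φ) full + extend as (λ φ → 2 * ℓ * ∑ bs (deficit φ)) full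
            ≡⟨ cong₂ _+_ (extend-* as θ (count (v ∷ bs)) full)
                 (≡-trans (extend-* as (2 * ℓ) _ full) (cong (2 * ℓ *_) (extend-∑ as bs (λ u φ → deficit φ u) full))) ⟩
          θ * extend as (count (v ∷ bs)) full + 2 * ℓ * D   ≡⟨ cong₂ (λ p q → θ * p + q) (≡-trans (sym (extend-++ as (v ∷ bs) _ full)) (sym (count-↭ split′ full))) (*-assoc 2 ℓ D) ⟩
          θ * c′ + 2 * (ℓ * D)                              ≤⟨ +-monoʳ-≤ (θ * c′) (*-monoʳ-≤ 2 ℓD≤) ⟩
          θ * c′ + 2 * (Δ * (t * c))                        ≡⟨ cong (θ * c′ +_) (lem₂ Δ t c) ⟩
          θ * c′ + 2 * (Δ * t) * c                          ≤⟨ +-monoʳ-≤ (θ * c′) (*-monoˡ-≤ c 2Δt≤ℓθ) ⟩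
          θ * c′ + ℓ * θ * c                                ∎
          where
          c = count vs full
          c′ = count (v ∷ vs) full
          D = ∑ bs (λ u → extend as (λ φ → deficit φ u) full)
          split′ : v ∷ vs ↭ as ++ v ∷ bs
          split′ = ↭-trans (prep v split) (↭-sym (shift v as bs))
          ℓD≤ : ℓ * D ≤ Δ * (t * c)
          ℓD≤ = begin
            ℓ * D                     ≡⟨ ∑-distribˡ-* ℓ bs _ ⟨
            ∑ bs (λ u → ℓ * extend as (λ φ → deficit φ u) full) ≤⟨ ∑-bound bs deficit-bound ⟩
            length bs * (t * c)       ≤⟨ *-monoˡ-≤ (t * c) |bs|≤Δ ⟩
            Δ * (t * c)               ∎
          lem : ∀ ℓ θ c → θ * (ℓ * c) + ℓ * θ * c ≡ 2 * ℓ * θ * c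
          lem = solve-∀
          lem₂ : ∀ a b c → 2 * (a * (b * c)) ≡ 2 * (a * b) * c
          lem₂ = solve-∀

      -- Induction on the length, because the hypothesis is needed for `vs` with an arbitrary vertex
      -- deleted, in any order.
      count-grows : ∀ N {v vs} → length vs ≡ N → Unique (v ∷ vs) → ℓ * count vs full ≤ count (v ∷ vs) full
      count-grows zero    {vs = []} |vs|≡N uniq = count-step uniq (λ p → contradiction (↭-sym p) ¬x∷xs↭[])
      count-grows (suc N) {v} {vs} |vs|≡N uniq@(_ ∷ uniq′) = count-step uniq (λ p →
        count-grows N (suc-injective (≡-trans (sym (↭-length p)) |vs|≡N)) (Unique-↭ p uniq′))

      count-positive : ∀ {vs} → Unique vs → 0 < count vs full
      count-positive []                          = z<s
      count-positive {v ∷ vs} uniq@(_ ∷ uniq′) = <-≤-trans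
        (subst (_< ℓ * count vs full) (*-zeroʳ ℓ) (*-monoʳ-< ℓ (count-positive uniq′)))
        (count-grows (length vs) ≡-refl uniq)

      coloring : Fin k → CoverColoring C
      coloring i₀ = count-positive⇒coloring i₀ (count-positive (allFin⁺ n))

-- Choice of k, ℓ, θ and y for large Δ

module ParameterChoice where

  open Inequalities
  open import Data.Nat
  open import Data.Nat.DivMod using (m≡m%n+[m/n]*n; m%n<n; /-monoˡ-≤; m*n/n≡m)
  open import Data.Nat.Properties
  open import Data.Nat.Tactic.RingSolver using (solve-∀)
  open import Data.Product using (_,_; proj₁; proj₂; ∃; _×_)
  open import Relation.Binary.PropositionalEquality
  open import Relation.Nullary using (Dec; yes; no; ¬_; contradiction)

  last-true : ∀ {P : ℕ → Set} → (∀ n → Dec (P n)) → P 0 → ∀ {b} → ¬ P b → ∃ λ n → P n × ¬ P (suc n)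
  last-true P? P0 {zero}  ¬P0 = contradiction P0 ¬P0
  last-true P? P0 {suc b} ¬Pb with P? b
  ... | yes Pb = b , Pb , ¬Pb
  ... | no ¬P  = last-true P? P0 ¬P

  n<2^n : ∀ n → n < 2 ^ n
  n<2^n zero    = s≤s z≤n
  n<2^n (suc n) = begin
    suc (suc n)        ≤⟨ +-mono-≤ (m^n>0 2 n) (n<2^n n) ⟩
    2 ^ n + 2 ^ n      ≡⟨ cong (2 ^ n +_) (+-identityʳ (2 ^ n)) ⟨
    2 ^ suc n          ∎
    where open ≤-Reasoning

  ^-cancelʳ-< : ∀ n {a b} → a ^ n < b ^ n → a < b
  ^-cancelʳ-< n lt = ≰⇒> λ b≤a → <⇒≱ lt (^-monoˡ-≤ n b≤a)

  floor-root : ∀ n b → ∃ λ x → x ^ suc n ≤ b × b < suc x ^ suc n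
  floor-root n b =
    let x , le , ¬le = last-true (λ x → x ^ suc n ≤? b) z≤n {suc b} (<⇒≱ b<[1+b]^)
    in x , le , ≰⇒> ¬le
    where
    b<[1+b]^ : b < suc b ^ suc n
    b<[1+b]^ = subst (_≤ suc b ^ suc n) (*-identityʳ (suc b)) (^-monoʳ-≤ (suc b) (s≤s (z≤n {n})))

  -- The floor of the base-b logarithm of (t/s)^n. The search stops by t^n because m < 2^m ≤ b^m.
  floor-log : ∀ {b s t} .{{_ : NonZero s}} n → 2 ≤ b → s ≤ t →
              ∃ λ k → b ^ k * s ^ n ≤ t ^ n × t ^ n < b ^ suc k * s ^ n
  floor-log {b} {s} {t} n 2≤b s≤t =
    let k , le , ¬le = last-true (λ k → b ^ k * s ^ n ≤? t ^ n)
                         (≤-trans (≤-reflexive (*-identityˡ _)) (^-monoˡ-≤ n s≤t)) {t ^ n} (<⇒≱ too-many)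
    in k , le , ≰⇒> ¬le
    where
    open ≤-Reasoning
    too-many : t ^ n < b ^ (t ^ n) * s ^ n
    too-many = begin-strict
      t ^ n                    <⟨ n<2^n (t ^ n) ⟩
      2 ^ (t ^ n)              ≤⟨ ^-monoˡ-≤ (t ^ n) 2≤b ⟩
      b ^ (t ^ n)              ≤⟨ m≤m*n _ (s ^ n) {{m^n≢0 s n}} ⟩
      b ^ (t ^ n) * s ^ n      ∎

  [1+n]²≤4*2^n : ∀ n → suc n * suc n ≤ 4 * 2 ^ n
  [1+n]²≤4*2^n 0 = s≤s z≤n
  [1+n]²≤4*2^n 1 = m≤m+n 4 4
  [1+n]²≤4*2^n 2 = m≤m+n 9 7
  -- The doubling step (n+2)² ≤ 2(n+1)² needs n² ≥ 2, hence three base cases.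
  [1+n]²≤4*2^n (suc n@(suc (suc m))) = begin
    suc (suc n) * suc (suc n)                              ≤⟨ m≤m+n _ (2 + m * m + 4 * m) ⟩
    suc (suc n) * suc (suc n) + (2 + m * m + 4 * m)        ≡⟨ lem m ⟩
    2 * (suc n * suc n)                                    ≤⟨ *-monoʳ-≤ 2 ([1+n]²≤4*2^n n) ⟩
    2 * (4 * 2 ^ n)                                        ≡⟨ lem₂ (2 ^ n) ⟩
    4 * 2 ^ suc n                                          ∎
    where
    open ≤-Reasoning
    lem : ∀ m → (4 + m) * (4 + m) + (2 + m * m + 4 * m) ≡ 2 * ((3 + m) * (3 + m))
    lem = solve-∀
    lem₂ : ∀ a → 2 * (4 * a) ≡ 4 * (2 * a)
    lem₂ = solve-∀

  -- For y = ⌊x/q⌋ one has 1 + x ≤ q(1 + y), and y ≥ 4q turns this into 4(1 + x) ≤ (1 + y)² ≤ 4 ·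
  -- 2^y. Then take q-th powers.
  power≤exponential : ∀ q → ∃ λ x₀ → ∀ {x} → x₀ ≤ x → suc x ^ q ≤ 2 ^ x
  power≤exponential zero       = 0 , λ {x} _ → m^n>0 2 x
  power≤exponential q@(suc q′) = 4 * q * q , bound
    where
    open ≤-Reasoning
    bound : ∀ {x} → 4 * q * q ≤ x → suc x ^ q ≤ 2 ^ x
    bound {x} 4q²≤x = begin
      suc x ^ q         ≤⟨ ^-monoˡ-≤ q (*-cancelˡ-≤ {suc x} {2 ^ y} 4 4[1+x]≤) ⟩
      (2 ^ y) ^ q       ≡⟨ ^-*-assoc 2 y q ⟩
      2 ^ (y * q)       ≤⟨ ^-monoʳ-≤ 2 (≤-trans (m≤n+m _ (x % q)) (≤-reflexive (sym (m≡m%n+[m/n]*n x q)))) ⟩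
      2 ^ x             ∎
      where
      y = x / q
      4q≤y : 4 * q ≤ y
      4q≤y = subst (_≤ y) (m*n/n≡m (4 * q) q) (/-monoˡ-≤ q 4q²≤x)
      x<q+yq : suc x ≤ q + y * q
      x<q+yq = begin
        suc x                      ≡⟨ cong suc (m≡m%n+[m/n]*n x q) ⟩
        suc (x % q) + y * q        ≤⟨ +-monoˡ-≤ (y * q) (m%n<n x q) ⟩
        q + y * q                  ∎
      lem : ∀ q y → 4 * (q + y * q) ≡ 4 * q * (1 + y)
      lem = solve-∀
      4[1+x]≤ : 4 * suc x ≤ 4 * 2 ^ y
      4[1+x]≤ = begin
        4 * suc x                  ≤⟨ *-monoʳ-≤ 4 x<q+yq ⟩
        4 * (q + y * q)            ≡⟨ lem q y ⟩
        4 * q * suc y              ≤⟨ *-monoˡ-≤ (suc y) (≤-trans 4q≤y (n≤1+n y)) ⟩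
        suc y * suc y              ≤⟨ [1+n]²≤4*2^n y ⟩
        4 * 2 ^ y                  ∎

  -- k colors; ℓ is the growth factor of the count, t = s + 1 the threshold of a small list, θ the number
  -- of small neighbours tolerated, and y a lower bound for (number of usable colors) / 2ℓ.
  record Parameters (s Δ : ℕ) : Set where
    field
      k ℓ θ y       : ℕ
      {{ℓ≢0}}       : NonZero ℓ
      {{θ≢0}}       : NonZero θ
      {{y≢0}}       : NonZero y
      2Δt≤ℓθ        : 2 * (Δ * suc s) ≤ ℓ * θ
      many-colors   : 2 * ℓ * y + suc s * θ ≤ k
      growth        : suc s ^ (suc s * Δ) ≤ y ^ (k ∸ suc s * θ) * s ^ (suc s * Δ)
      few-colors    : Δ ^ k * s ^ ((2 + s) * Δ) ≤ suc s ^ ((2 + s) * Δ)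

  -- `exponent-gap` says (s+1)/(s+2) ≤ (r/p)((r+2)/p). The factor r/p is lost between Δ < (1+x)^p
  -- and (1+x)^r ≤ y, the factor (r+2)/p between k + 1 and k′.
  module _ (s r : ℕ) .{{_ : NonZero s}}
    (exponent-gap : suc s * ((3 + r) * (3 + r)) ≤ (2 + s) * (r * (2 + r))) where

    private
      t p C D x₀ : ℕ
      t = suc s
      p = 3 + r
      -- tθ = CX, and DX ≤ k leaves room for 2xy = 2X as well as for `k′-large`.
      C = t * (2 * t * 2 ^ p)
      D = p * suc C
      -- Ensures x ≥ 1, then (1+x)^r ≤ 2^r x^r ≤ x^(1+r), then (1+x)^(pD) ≤ 2^x.
      x₀ = suc (2 ^ r + proj₁ (power≤exponential (p * D)))

      -- Bernoulli. This crude bound serves to force k up to order Δ^(1-1/p).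
      2s^≤t^ : 2 * s ^ (2 + s) ≤ t ^ (2 + s)
      2s^≤t^ = begin
        2 * s ^ (2 + s)                      ≤⟨ m≤m+n _ (2 * s ^ (1 + s)) ⟩
        2 * s ^ (2 + s) + 2 * s ^ (1 + s)    ≡⟨ lem s (s ^ (1 + s)) ⟩
        s ^ (1 + s) * (s + (2 + s) * 1)      ≤⟨ bernoulli s 1 (1 + s) ⟩
        (s + 1) ^ (2 + s)                    ≡⟨ cong (_^ (2 + s)) (+-comm s 1) ⟩
        t ^ (2 + s)                          ∎
        where
        open ≤-Reasoning
        lem : ∀ s a → 2 * (s * a) + 2 * a ≡ a * (s + (2 + s) * 1)
        lem = solve-∀

      2^Δs^≤t^ : ∀ Δ → 2 ^ Δ * s ^ ((2 + s) * Δ) ≤ t ^ ((2 + s) * Δ)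
      2^Δs^≤t^ Δ = begin
        2 ^ Δ * s ^ ((2 + s) * Δ)       ≡⟨ cong (2 ^ Δ *_) (^-*-assoc s (2 + s) Δ) ⟨
        2 ^ Δ * (s ^ (2 + s)) ^ Δ       ≡⟨ ^-distrib-* 2 (s ^ (2 + s)) Δ ⟨
        (2 * s ^ (2 + s)) ^ Δ           ≤⟨ ^-monoˡ-≤ Δ 2s^≤t^ ⟩
        (t ^ (2 + s)) ^ Δ               ≡⟨ ^-*-assoc t (2 + s) Δ ⟩
        t ^ ((2 + s) * Δ)               ∎
        where open ≤-Reasoning

      -- x ≈ Δ^{1/p} and k is the largest number with Δ^k ≤ (1 + 1/s)^{(s+2)Δ}, so k ≈ (1 + O(1/s)) Δ / ln Δ,
      -- whereas θ ≈ Δ^{1−1/p} is negligible.  The growth condition needs x^{(p−2)k′} ≥ (1 + 1/s)^{(s+1)Δ}: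
      -- the gap between s + 2 and s + 1 pays for p − 2 in place of p, and for k′ in place of k.
      module Construction {Δ x k : ℕ} (x₀≤x : x₀ ≤ x) (x^p≤Δ : x ^ p ≤ Δ) (Δ<[1+x]^p : Δ < suc x ^ p)
        (few  : Δ ^ k * s ^ ((2 + s) * Δ) ≤ t ^ ((2 + s) * Δ))
        (many : t ^ ((2 + s) * Δ) < Δ ^ suc k * s ^ ((2 + s) * Δ))
        where
        open ≤-Reasoning
        N X y θ k′ : ℕ
        N = (2 + s) * Δ
        X = x ^ (2 + r)
        y = x ^ (1 + r)
        -- Makes xθ = 2t · 2^p x^p, while Δ < (1+x)^p ≤ 2^p x^p.
        θ = 2 * t * 2 ^ p * X
        k′ = k ∸ t * θ

        instance
          x≢0 : NonZero x
          x≢0 = >-nonZero (≤-trans z<s x₀≤x)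
          X≢0 : NonZero X
          X≢0 = m^n≢0 x (2 + r)
          y≢0′ : NonZero y
          y≢0′ = m^n≢0 x (1 + r)
          θ≢0′ : NonZero θ
          θ≢0′ = m*n≢0 (2 * t * 2 ^ p) X {{m*n≢0 (2 * t) (2 ^ p) {{_}} {{m^n≢0 2 p}}}}

        [1+x]^n≤2^nx^n : ∀ n → suc x ^ n ≤ 2 ^ n * x ^ n
        [1+x]^n≤2^nx^n n = begin
          suc x ^ n         ≤⟨ ^-monoˡ-≤ n (+-mono-≤ (>-nonZero⁻¹ x) (m≤m+n x 0)) ⟩
          (2 * x) ^ n       ≡⟨ ^-distrib-* 2 x n ⟩
          2 ^ n * x ^ n     ∎

        [1+x]^r≤y : suc x ^ r ≤ y
        [1+x]^r≤y = begin
          suc x ^ r         ≤⟨ [1+x]^n≤2^nx^n r ⟩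
          2 ^ r * x ^ r     ≤⟨ *-monoˡ-≤ (x ^ r) (≤-trans (≤-trans (m≤m+n (2 ^ r) _) (n≤1+n _)) x₀≤x) ⟩
          y                 ∎

        [1+x]^pD≤2^x : suc x ^ (p * D) ≤ 2 ^ x
        [1+x]^pD≤2^x = proj₂ (power≤exponential (p * D)) (≤-trans (≤-trans (m≤n+m _ (2 ^ r)) (n≤1+n _)) x₀≤x)

        2Δt≤xθ : 2 * (Δ * t) ≤ x * θ
        2Δt≤xθ = begin
          2 * (Δ * t)                  ≤⟨ *-monoʳ-≤ 2 (*-monoˡ-≤ t (≤-trans (<⇒≤ Δ<[1+x]^p) ([1+x]^n≤2^nx^n p))) ⟩
          2 * (2 ^ p * (x * X) * t)    ≡⟨ lem (2 ^ p) x X t ⟩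
          x * θ                        ∎
          where
          lem : ∀ a x X t → 2 * (a * (x * X) * t) ≡ x * (2 * t * a * X)
          lem = solve-∀

        2^Δ<Δ^ : 2 ^ Δ < Δ ^ suc k
        2^Δ<Δ^ = *-cancelʳ-< _ (2 ^ Δ) (Δ ^ suc k) (≤-<-trans (2^Δs^≤t^ Δ) many)

        -- Otherwise Δ^(k+1) ≤ (1+x)^(pDX) ≤ 2^(xX) ≤ 2^Δ, against the maximality of k.
        DX≤k : D * X ≤ k
        DX≤k = ≮⇒≥ λ k<DX → <-irrefl refl (begin-strict
          2 ^ Δ                     <⟨ 2^Δ<Δ^ ⟩
          Δ ^ suc k                 ≤⟨ ^-monoˡ-≤ (suc k) (<⇒≤ Δ<[1+x]^p) ⟩
          (suc x ^ p) ^ suc k       ≤⟨ ^-monoʳ-≤ (suc x ^ p) {{m^n≢0 (suc x) p}} k<DX ⟩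
          (suc x ^ p) ^ (D * X)     ≡⟨ ^-*-assoc (suc x ^ p) D X ⟨
          ((suc x ^ p) ^ D) ^ X     ≡⟨ cong (_^ X) (^-*-assoc (suc x) p D) ⟩
          (suc x ^ (p * D)) ^ X     ≤⟨ ^-monoˡ-≤ X [1+x]^pD≤2^x ⟩
          (2 ^ x) ^ X               ≡⟨ ^-*-assoc 2 x X ⟩
          2 ^ (x * X)               ≤⟨ ^-monoʳ-≤ 2 x^p≤Δ ⟩
          2 ^ Δ                     ∎)

        tθ≡CX : t * θ ≡ C * X
        tθ≡CX = sym (*-assoc t (2 * t * 2 ^ p) X)

        2xy+tθ≤k : 2 * x * y + t * θ ≤ k
        2xy+tθ≤k = begin
          2 * x * y + t * θ          ≡⟨ cong₂ _+_ (*-assoc 2 x y) tθ≡CX ⟩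
          2 * X + C * X              ≤⟨ m≤m+n _ ((1 + r) * X + (2 + r) * C * X) ⟩
          2 * X + C * X + ((1 + r) * X + (2 + r) * C * X) ≡⟨ lem r C X ⟩
          D * X                      ≤⟨ DX≤k ⟩
          k                          ∎
          where
          lem : ∀ r C X → 2 * X + C * X + ((1 + r) * X + (2 + r) * C * X) ≡ (3 + r) * (1 + C) * X
          lem = solve-∀

        k≡tθ+k′ : k ≡ C * X + k′
        k≡tθ+k′ = trans (sym (m+[n∸m]≡n (≤-trans (m≤n+m (t * θ) (2 * x * y)) 2xy+tθ≤k))) (cong (_+ k′) tθ≡CX)

        -- As p = (2 + r) + 1, this amounts to (2 + r)(CX + 1) ≤ k′, which follows from `DX≤k`. It
        -- concerns k + 1 because maximality of k bounds (t/s)^N by Δ^(k+1).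
        k′-large : (2 + r) * suc k ≤ p * k′
        k′-large = begin
          (2 + r) * suc k                               ≡⟨ cong (λ z → (2 + r) * suc z) k≡tθ+k′ ⟩
          (2 + r) * suc (C * X + k′)                    ≡⟨ lem r C X k′ ⟩
          (2 + r) * (C * X) + (2 + r) * 1 + (2 + r) * k′ ≤⟨ +-monoˡ-≤ ((2 + r) * k′) (+-cancelˡ-≤ (C * X) _ _ (begin
              C * X + ((2 + r) * (C * X) + (2 + r) * 1)         ≤⟨ +-monoʳ-≤ (C * X) (+-monoʳ-≤ ((2 + r) * (C * X)) (*-monoʳ-≤ (2 + r) (>-nonZero⁻¹ X))) ⟩
              C * X + ((2 + r) * (C * X) + (2 + r) * X)         ≤⟨ m≤m+n _ X ⟩
              C * X + ((2 + r) * (C * X) + (2 + r) * X) + X     ≡⟨ lem₂ r C X ⟩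
              D * X                                             ≤⟨ DX≤k ⟩
              k                                                 ≡⟨ k≡tθ+k′ ⟩
              C * X + k′                                        ∎)) ⟩
          p * k′                                        ∎
          where
          lem : ∀ r C X k′ → (2 + r) * (1 + (C * X + k′)) ≡ (2 + r) * (C * X) + (2 + r) * 1 + (2 + r) * k′
          lem = solve-∀
          lem₂ : ∀ r C X → C * X + ((2 + r) * (C * X) + (2 + r) * X) + X ≡ (3 + r) * (1 + C) * X
          lem₂ = solve-∀

        -- Exponents are multiplied by p² to clear the denominators of r/p and (r+2)/p.
        M M′ Z : ℕ
        M = N * (r * (2 + r))
        M′ = t * Δ * (p * p)
        Z = (Δ ^ suc k) ^ (r * (2 + r))

        M′≤M : M′ ≤ M
        M′≤M = begin
          t * Δ * (p * p)                  ≡⟨ lem t Δ (p * p) ⟩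
          t * (p * p) * Δ                  ≤⟨ *-monoˡ-≤ Δ exponent-gap ⟩
          (2 + s) * (r * (2 + r)) * Δ      ≡⟨ lem (2 + s) (r * (2 + r)) Δ ⟩
          M                                ∎
          where
          lem : ∀ a b c → a * b * c ≡ a * c * b
          lem = solve-∀

        -- (t/s)^M′ ≤ (t/s)^M ≤ Z, the latter being `many` raised to the power r(2 + r).
        t^M′≤ : t ^ M′ ≤ Z * s ^ M′
        t^M′≤ = *-cancelʳ-≤ _ _ (s ^ e) {{m^n≢0 s e}} (begin
          t ^ M′ * s ^ e                             ≤⟨ *-monoʳ-≤ (t ^ M′) (^-monoˡ-≤ e (n≤1+n s)) ⟩
          t ^ M′ * t ^ e                             ≡⟨ ^-distribˡ-+-* t M′ e ⟨
          t ^ (M′ + e)                               ≡⟨ cong (t ^_) M′+e≡M ⟩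
          t ^ M                                      ≡⟨ ^-*-assoc t N (r * (2 + r)) ⟨
          (t ^ N) ^ (r * (2 + r))                    ≤⟨ ^-monoˡ-≤ (r * (2 + r)) (<⇒≤ many) ⟩
          (Δ ^ suc k * s ^ N) ^ (r * (2 + r))        ≡⟨ ^-distrib-* (Δ ^ suc k) (s ^ N) (r * (2 + r)) ⟩
          Z * (s ^ N) ^ (r * (2 + r))                ≡⟨ cong (Z *_) (^-*-assoc s N (r * (2 + r))) ⟩
          Z * s ^ M                                  ≡⟨ cong (λ z → Z * s ^ z) M′+e≡M ⟨
          Z * s ^ (M′ + e)                           ≡⟨ cong (Z *_) (^-distribˡ-+-* s M′ e) ⟩
          Z * (s ^ M′ * s ^ e)                       ≡⟨ *-assoc Z _ _ ⟨
          Z * s ^ M′ * s ^ e                         ∎)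
          where
          e = M ∸ M′
          M′+e≡M : M′ + e ≡ M
          M′+e≡M = m+[n∸m]≡n M′≤M

        Z≤ : Z ≤ y ^ (k′ * (p * p))
        Z≤ = begin
          (Δ ^ suc k) ^ (r * (2 + r))                  ≡⟨ ^-*-assoc Δ (suc k) (r * (2 + r)) ⟩
          Δ ^ (suc k * (r * (2 + r)))                  ≤⟨ ^-monoˡ-≤ (suc k * (r * (2 + r))) (<⇒≤ Δ<[1+x]^p) ⟩
          (suc x ^ p) ^ (suc k * (r * (2 + r)))        ≡⟨ ^-*-assoc (suc x) p (suc k * (r * (2 + r))) ⟩
          suc x ^ (p * (suc k * (r * (2 + r))))        ≡⟨ cong (suc x ^_) (lem p (suc k) r) ⟩
          suc x ^ (r * (p * ((2 + r) * suc k)))        ≡⟨ ^-*-assoc (suc x) r _ ⟨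
          (suc x ^ r) ^ (p * ((2 + r) * suc k))        ≤⟨ ^-monoˡ-≤ (p * ((2 + r) * suc k)) [1+x]^r≤y ⟩
          y ^ (p * ((2 + r) * suc k))                  ≤⟨ ^-monoʳ-≤ y (*-monoʳ-≤ p k′-large) ⟩
          y ^ (p * (p * k′))                           ≡⟨ cong (y ^_) (lem₂ p k′) ⟩
          y ^ (k′ * (p * p))                           ∎
          where
          lem : ∀ p k r → p * (k * (r * (2 + r))) ≡ r * (p * ((2 + r) * k))
          lem = solve-∀
          lem₂ : ∀ p k → p * (p * k) ≡ k * (p * p)
          lem₂ = solve-∀

        growth′ : t ^ (t * Δ) ≤ y ^ k′ * s ^ (t * Δ)
        growth′ = ^-cancelʳ-≤ (p * p) (begin
          (t ^ (t * Δ)) ^ (p * p)                      ≡⟨ ^-*-assoc t (t * Δ) (p * p) ⟩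
          t ^ M′                                       ≤⟨ t^M′≤ ⟩
          Z * s ^ M′                                   ≤⟨ *-monoˡ-≤ (s ^ M′) Z≤ ⟩
          y ^ (k′ * (p * p)) * s ^ M′                  ≡⟨ cong₂ _*_ (^-*-assoc y k′ (p * p)) (^-*-assoc s (t * Δ) (p * p)) ⟨
          (y ^ k′) ^ (p * p) * (s ^ (t * Δ)) ^ (p * p) ≡⟨ ^-distrib-* (y ^ k′) (s ^ (t * Δ)) (p * p) ⟨
          (y ^ k′ * s ^ (t * Δ)) ^ (p * p)             ∎)

        parameters : Parameters s Δ
        parameters = record
          { k = k ; ℓ = x ; θ = θ ; y = y
          ; 2Δt≤ℓθ = 2Δt≤xθ ; many-colors = 2xy+tθ≤k ; growth = growth′ ; few-colors = few }

    parameters-from-gap : ∃ λ Δ₀ → ∀ Δ → Δ₀ ≤ Δ → Parameters s Δ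
    -- The 2 makes Δ a valid base for `floor-log`; x₀^p ≤ Δ < (1+x)^p forces x₀ ≤ x.
    parameters-from-gap = 2 + x₀ ^ p , λ Δ Δ₀≤Δ →
      let x , x^p≤Δ , Δ<[1+x]^p = floor-root (2 + r) Δ
          k , few , many = floor-log ((2 + s) * Δ) (≤-trans (m≤m+n 2 (x₀ ^ p)) Δ₀≤Δ) (n≤1+n s)
          x₀<1+x = ^-cancelʳ-< p (≤-<-trans (≤-trans (m≤n+m (x₀ ^ p) 2) Δ₀≤Δ) Δ<[1+x]^p)
      in Construction.parameters {Δ} {x} {k} (s≤s⁻¹ x₀<1+x) x^p≤Δ Δ<[1+x]^p few many

  parameters-exist : ∀ s .{{_ : NonZero s}} → ∃ λ Δ₀ → ∀ Δ → Δ₀ ≤ Δ → Parameters s Δ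
  -- The gap condition reads r(r - 4s - 2) ≥ 9(s + 1); r = 4s + 8 makes the left side 6r, with 15s +
  -- 39 to spare.
  parameters-exist s = parameters-from-gap s (4 * s + 8) (≤-trans (m≤m+n _ (15 * s + 39)) (≤-reflexive (lem s)))
    where
    lem : ∀ s → (1 + s) * ((3 + (4 * s + 8)) * (3 + (4 * s + 8))) + (15 * s + 39) ≡
                (2 + s) * ((4 * s + 8) * (2 + (4 * s + 8)))
    lem = solve-∀

-- Rational arithmetic and lower bounds for partial sums of the exponential series

module Exponential where

  open import Data.Integer using (+_; +[1+_])
  import Data.Integer as ℤ
  import Data.Integer.Properties as ℤ
  open import Data.Nat using (ℕ; zero; suc)
  import Data.Nat as ℕ
  import Data.Nat.Properties as ℕ
  import Data.Nat.Tactic.RingSolver as ℕ-Solver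
  open import Data.Product using (∃; _,_)
  open import Data.Rational
    using (ℚ; mkℚ; 0ℚ; 1ℚ; _+_; _*_; _/_; _≤_; _<_; *<*; toℚᵘ; fromℚᵘ; nonNegative; Positive)
  open import Data.Rational.Properties
  import Data.Rational.Unnormalised as ℚᵘ
  import Data.Rational.Unnormalised.Properties as ℚᵘ
  open import Relation.Binary.PropositionalEquality
  open import Relation.Nullary.Decidable using (dec⇒maybe)
  open import Tactic.RingSolver using (solve-∀)
  open import Tactic.RingSolver.Core.AlmostCommutativeRing using (AlmostCommutativeRing; fromCommutativeRing)

  ℚ-ring : AlmostCommutativeRing _ _
  ℚ-ring = fromCommutativeRing +-*-commutativeRing λ p → dec⇒maybe (0ℚ ≟ p)

  -- `a / suc n` is by definition `fromℚᵘ` of an unnormalised fraction, where identities are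
  -- cross-multiplications without gcds.
  fromℚᵘ-homo-+ : ∀ p q → fromℚᵘ (p ℚᵘ.+ q) ≡ fromℚᵘ p + fromℚᵘ q
  fromℚᵘ-homo-+ p q = toℚᵘ-injective (begin
    toℚᵘ (fromℚᵘ (p ℚᵘ.+ q))                ≈⟨ toℚᵘ-fromℚᵘ (p ℚᵘ.+ q) ⟩
    p ℚᵘ.+ q                                ≈⟨ ℚᵘ.+-cong (toℚᵘ-fromℚᵘ p) (toℚᵘ-fromℚᵘ q) ⟨
    toℚᵘ (fromℚᵘ p) ℚᵘ.+ toℚᵘ (fromℚᵘ q)    ≈⟨ toℚᵘ-homo-+ (fromℚᵘ p) (fromℚᵘ q) ⟨
    toℚᵘ (fromℚᵘ p + fromℚᵘ q)              ∎)
    where open import Relation.Binary.Reasoning.Setoid ℚᵘ.≃-setoid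

  fromℚᵘ-homo-* : ∀ p q → fromℚᵘ (p ℚᵘ.* q) ≡ fromℚᵘ p * fromℚᵘ q
  fromℚᵘ-homo-* p q = toℚᵘ-injective (begin
    toℚᵘ (fromℚᵘ (p ℚᵘ.* q))                ≈⟨ toℚᵘ-fromℚᵘ (p ℚᵘ.* q) ⟩
    p ℚᵘ.* q                                ≈⟨ ℚᵘ.*-cong (toℚᵘ-fromℚᵘ p) (toℚᵘ-fromℚᵘ q) ⟨
    toℚᵘ (fromℚᵘ p) ℚᵘ.* toℚᵘ (fromℚᵘ q)    ≈⟨ toℚᵘ-homo-* (fromℚᵘ p) (fromℚᵘ q) ⟨
    toℚᵘ (fromℚᵘ p * fromℚᵘ q)              ∎)
    where open import Relation.Binary.Reasoning.Setoid ℚᵘ.≃-setoid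

  ℕtoℚ-* : ∀ a b → ℕtoℚ (a ℕ.* b) ≡ ℕtoℚ a * ℕtoℚ b
  ℕtoℚ-* a b = trans (cong (_/ 1) (ℤ.pos-* a b)) (fromℚᵘ-homo-* (ℚᵘ.mkℚᵘ (+ a) 0) (ℚᵘ.mkℚᵘ (+ b) 0))

  ℕtoℚ-+ : ∀ a b → ℕtoℚ (a ℕ.+ b) ≡ ℕtoℚ a + ℕtoℚ b
  ℕtoℚ-+ a b = trans (cong (_/ 1) (trans (ℤ.pos-+ a b) (cong₂ ℤ._+_ (sym (ℤ.*-identityʳ (+ a))) (sym (ℤ.*-identityʳ (+ b))))))
    (fromℚᵘ-homo-+ (ℚᵘ.mkℚᵘ (+ a) 0) (ℚᵘ.mkℚᵘ (+ b) 0))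

  fromℚᵘ-mono-≤ : ∀ {p q} → p ℚᵘ.≤ q → fromℚᵘ p ≤ fromℚᵘ q
  fromℚᵘ-mono-≤ {p} {q} p≤q = toℚᵘ-cancel-≤
    (ℚᵘ.≤-respˡ-≃ (ℚᵘ.≃-sym (toℚᵘ-fromℚᵘ p)) (ℚᵘ.≤-respʳ-≃ (ℚᵘ.≃-sym (toℚᵘ-fromℚᵘ q)) p≤q))

  ℕtoℚ-mono : ∀ {a b} → a ℕ.≤ b → ℕtoℚ a ≤ ℕtoℚ b
  ℕtoℚ-mono {a} {b} a≤b = fromℚᵘ-mono-≤ {ℚᵘ.mkℚᵘ (+ a) 0} {ℚᵘ.mkℚᵘ (+ b) 0} (ℚᵘ.*≤* (ℤ.*-monoʳ-≤-nonNeg (+ 1) (ℤ.+≤+ a≤b)))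

  ℕtoℚ≥0 : ∀ a → 0ℚ ≤ ℕtoℚ a
  ℕtoℚ≥0 a = ℕtoℚ-mono {0} {a} ℕ.z≤n

  /-unfold : ∀ a n → (+ a) / suc n ≡ ℕtoℚ a * ((+ 1) / suc n)
  /-unfold a n = trans (fromℚᵘ-cong {ℚᵘ.mkℚᵘ (+ a) n} {ℚᵘ.mkℚᵘ (+ a) 0 ℚᵘ.* ℚᵘ.mkℚᵘ (+ 1) n} (ℚᵘ.*≡* (trans (cong (λ d → + a ℤ.* +[1+ d ]) (ℕ.+-identityʳ n))
    (cong (ℤ._* +[1+ n ]) (sym (ℤ.*-identityʳ (+ a)))))))
    (fromℚᵘ-homo-* (ℚᵘ.mkℚᵘ (+ a) 0) (ℚᵘ.mkℚᵘ (+ 1) n))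

  /-inverse : ∀ n → ℕtoℚ (suc n) * ((+ 1) / suc n) ≡ 1ℚ
  /-inverse n = trans (sym (/-unfold (suc n) n)) (fromℚᵘ-cong {ℚᵘ.mkℚᵘ +[1+ n ] n} {ℚᵘ.mkℚᵘ (+ 1) 0} (ℚᵘ.*≡* (ℤ.*-comm +[1+ n ] (+ 1))))

  1/≥0 : ∀ n → 0ℚ ≤ (+ 1) / suc n
  1/≥0 n = fromℚᵘ-mono-≤ {ℚᵘ.mkℚᵘ (+ 0) 0} {ℚᵘ.mkℚᵘ (+ 1) n} (ℚᵘ.*≤* (ℤ.+≤+ ℕ.z≤n))

  *-mono-≤ : ∀ {p q r s} → 0ℚ ≤ p → 0ℚ ≤ s → p ≤ q → r ≤ s → p * r ≤ q * s
  *-mono-≤ {p} {q} {r} {s} 0≤p 0≤s p≤q r≤s = ≤-trans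
    (*-monoˡ-≤-nonNeg p {{nonNegative 0≤p}} r≤s) (*-monoʳ-≤-nonNeg s {{nonNegative 0≤s}} p≤q)

  *≥0 : ∀ {p q} → 0ℚ ≤ p → 0ℚ ≤ q → 0ℚ ≤ p * q
  *≥0 {p} {q} 0≤p 0≤q = ≤-trans (≤-reflexive (sym (*-zeroˡ q))) (*-monoʳ-≤-nonNeg q {{nonNegative 0≤q}} 0≤p)

  +≥0 : ∀ {p q} → 0ℚ ≤ p → 0ℚ ≤ q → 0ℚ ≤ p + q
  +≥0 = +-mono-≤

  p≤p+q : ∀ {p q} → 0ℚ ≤ q → p ≤ p + q
  p≤p+q {p} 0≤q = ≤-trans (≤-reflexive (sym (+-identityʳ p))) (+-monoʳ-≤ p 0≤q)

  expTerm≥0 : ∀ {x} → 0ℚ ≤ x → ∀ i → 0ℚ ≤ expTerm x i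
  expTerm≥0 0≤x zero    = ℕtoℚ≥0 1
  expTerm≥0 0≤x (suc i) = *≥0 (*≥0 (expTerm≥0 0≤x i) 0≤x) (1/≥0 i)

  expTerm-mono : ∀ {x y} → 0ℚ ≤ x → x ≤ y → ∀ i → expTerm x i ≤ expTerm y i
  expTerm-mono 0≤x x≤y zero    = ≤-refl
  expTerm-mono 0≤x x≤y (suc i) = *-mono-≤ (*≥0 (expTerm≥0 0≤x i) 0≤x) (1/≥0 i)
    (*-mono-≤ (expTerm≥0 0≤x i) (≤-trans 0≤x x≤y) (expTerm-mono 0≤x x≤y i) x≤y) ≤-refl

  expPartial-mono : ∀ {x y} → 0ℚ ≤ x → x ≤ y → ∀ n → expPartial x n ≤ expPartial y n
  expPartial-mono 0≤x x≤y zero    = ≤-refl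
  expPartial-mono 0≤x x≤y (suc n) = +-mono-≤ (expPartial-mono 0≤x x≤y n) (expTerm-mono 0≤x x≤y (suc n))

  -- Two terms of the binomial expansion of (a+z)^(i+1)/(i+1)!. The induction multiplies by
  -- (a+z)/(i+2) and drops the term in z².
  expTerm-+ : ∀ {a z} → 0ℚ ≤ a → 0ℚ ≤ z → ∀ i → expTerm a (suc i) + z * expTerm a i ≤ expTerm (a + z) (suc i)
  expTerm-+ {a} {z} 0≤a 0≤z zero    = ≤-reflexive (lem a z)
    where
    lem : ∀ a z → 1ℚ * a * 1ℚ + z * 1ℚ ≡ 1ℚ * (a + z) * 1ℚ
    lem = solve-∀ ℚ-ring
  expTerm-+ {a} {z} 0≤a 0≤z (suc i) = begin
    T₁ * a * w + z * T₁                       ≡⟨ lem₁ (T₁ * a * w) (z * T₁) ⟩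
    T₁ * a * w + z * T₁ * 1ℚ                  ≡⟨ cong (λ u → T₁ * a * w + z * T₁ * u) 1≡ ⟩
    T₁ * a * w + z * T₁ * ((1ℚ + I) * w)      ≡⟨ lem₂ (T₁ * a * w) z T₁ I w ⟩
    T₁ * a * w + (z * T₁ + z * (I * T₁)) * w  ≡⟨ cong (λ u → T₁ * a * w + (z * T₁ + z * u) * w) I*T₁ ⟩
    T₁ * a * w + (z * T₁ + z * (T₀ * a)) * w  ≤⟨ p≤p+q (*≥0 (*≥0 (*≥0 0≤z (expTerm≥0 0≤a i)) 0≤z) (1/≥0 (suc i))) ⟩
    T₁ * a * w + (z * T₁ + z * (T₀ * a)) * w + z * T₀ * z * w ≡⟨ lem₃ T₁ T₀ a z w ⟩
    (T₁ + z * T₀) * (a + z) * w               ≤⟨ *-monoʳ-≤-nonNeg w {{nonNegative (1/≥0 (suc i))}}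
                                                   (*-monoʳ-≤-nonNeg (a + z) {{nonNegative (+≥0 0≤a 0≤z)}} (expTerm-+ 0≤a 0≤z i)) ⟩
    expTerm (a + z) (suc i) * (a + z) * w     ∎
    where
    open ≤-Reasoning
    T₁ = expTerm a (suc i)
    T₀ = expTerm a i
    w = (+ 1) / suc (suc i)
    I = ℕtoℚ (suc i)
    1≡ : 1ℚ ≡ (1ℚ + I) * w
    1≡ = trans (sym (/-inverse (suc i))) (cong (_* w) (ℕtoℚ-+ 1 (suc i)))
    lem₀ : ∀ I t a v → I * (t * a * v) ≡ t * a * (I * v)
    lem₀ = solve-∀ ℚ-ring
    I*T₁ : I * T₁ ≡ T₀ * a
    I*T₁ = trans (lem₀ I T₀ a ((+ 1) / suc i)) (trans (cong (T₀ * a *_) (/-inverse i)) (*-identityʳ _))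
    lem₁ : ∀ p q → p + q ≡ p + q * 1ℚ
    lem₁ = solve-∀ ℚ-ring
    lem₂ : ∀ p z t I w → p + z * t * ((1ℚ + I) * w) ≡ p + (z * t + z * (I * t)) * w
    lem₂ = solve-∀ ℚ-ring
    lem₃ : ∀ t₁ t₀ a z w → t₁ * a * w + (z * t₁ + z * (t₀ * a)) * w + z * t₀ * z * w ≡ (t₁ + z * t₀) * (a + z) * w
    lem₃ = solve-∀ ℚ-ring

  -- Truncation of (1 + z)e^a ≤ e^(a+z): z times term i is absorbed by term i + 1, hence the extra
  -- term on the right.
  expPartial-+ : ∀ {a z} → 0ℚ ≤ a → 0ℚ ≤ z → ∀ n → (1ℚ + z) * expPartial a n ≤ expPartial (a + z) (suc n)
  expPartial-+ {a} {z} 0≤a 0≤z n = ≤-trans (≤-reflexive (lem z (expPartial a n)))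
    (≤-trans (+-monoˡ-≤ (z * expPartial a n) (p≤expPartial n)) (go n))
    where
    open ≤-Reasoning
    lem : ∀ z p → (1ℚ + z) * p ≡ p + z * p
    lem = solve-∀ ℚ-ring
    p≤expPartial : ∀ n → expPartial a n ≤ expPartial a (suc n)
    p≤expPartial n = p≤p+q (expTerm≥0 0≤a (suc n))
    go : ∀ n → expPartial a (suc n) + z * expPartial a n ≤ expPartial (a + z) (suc n)
    go zero    = ≤-trans (≤-reflexive (+-assoc 1ℚ (expTerm a 1) (z * 1ℚ))) (+-monoʳ-≤ 1ℚ (expTerm-+ 0≤a 0≤z 0))
    go (suc n) = begin
      expPartial a (suc n) + T₂ + z * (expPartial a n + T₁)        ≡⟨ lem₂ (expPartial a (suc n)) T₂ z (expPartial a n) T₁ ⟩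
      expPartial a (suc n) + z * expPartial a n + (T₂ + z * T₁)    ≤⟨ +-mono-≤ (go n) (expTerm-+ 0≤a 0≤z (suc n)) ⟩
      expPartial (a + z) (suc n) + expTerm (a + z) (suc (suc n))   ∎
      where
      T₁ = expTerm a (suc n)
      T₂ = expTerm a (suc (suc n))
      lem₂ : ∀ p t z q u → p + t + z * (q + u) ≡ p + z * q + (t + z * u)
      lem₂ = solve-∀ ℚ-ring

  -- Each factor 1 + 1/(m+1) costs one use of `expPartial-+` and one more term, so a finite partial
  -- sum suffices and no limit is taken.
  [1+1/m]^n≤exp : ∀ m n → ℕtoℚ (suc (suc m) ℕ.^ n) ≤ ℕtoℚ (suc m ℕ.^ n) * expPartial (ℕtoℚ n * ((+ 1) / suc m)) n
  [1+1/m]^n≤exp m zero    = ≤-refl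
  [1+1/m]^n≤exp m (suc n) = begin
    ℕtoℚ (suc (suc m) ℕ.* suc (suc m) ℕ.^ n)     ≡⟨ ℕtoℚ-* (suc (suc m)) (suc (suc m) ℕ.^ n) ⟩
    ℕtoℚ (suc (suc m)) * ℕtoℚ (suc (suc m) ℕ.^ n) ≤⟨ *-monoˡ-≤-nonNeg (ℕtoℚ (suc (suc m))) {{nonNegative (ℕtoℚ≥0 (suc (suc m)))}} ([1+1/m]^n≤exp m n) ⟩
    ℕtoℚ (suc (suc m)) * (p * e)                 ≡⟨ cong (_* (p * e)) M+1≡ ⟩
    M * (1ℚ + z) * (p * e)                       ≡⟨ lem M (1ℚ + z) p e ⟩
    M * p * ((1ℚ + z) * e)                       ≤⟨ *-monoˡ-≤-nonNeg (M * p) {{nonNegative (*≥0 (ℕtoℚ≥0 (suc m)) (ℕtoℚ≥0 (suc m ℕ.^ n)))}}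
                                                      (expPartial-+ (*≥0 (ℕtoℚ≥0 n) (1/≥0 m)) (1/≥0 m) n) ⟩
    M * p * expPartial (ℕtoℚ n * z + z) (suc n)  ≡⟨ cong₂ (λ a b → a * expPartial b (suc n)) (sym (ℕtoℚ-* (suc m) (suc m ℕ.^ n))) nz+z≡ ⟩
    ℕtoℚ (suc m ℕ.^ suc n) * expPartial (ℕtoℚ (suc n) * z) (suc n) ∎
    where
    open ≤-Reasoning
    z = (+ 1) / suc m
    M = ℕtoℚ (suc m)
    p = ℕtoℚ (suc m ℕ.^ n)
    e = expPartial (ℕtoℚ n * z) n
    lem : ∀ a b c d → a * b * (c * d) ≡ a * c * (b * d)
    lem = solve-∀ ℚ-ring
    lem₂ : ∀ M z → M + M * z ≡ M * (1ℚ + z)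
    lem₂ = solve-∀ ℚ-ring
    lem₃ : ∀ n z → n * z + z ≡ (1ℚ + n) * z
    lem₃ = solve-∀ ℚ-ring
    M+1≡ : ℕtoℚ (suc (suc m)) ≡ M * (1ℚ + z)
    M+1≡ = trans (ℕtoℚ-+ 1 (suc m)) (trans (+-comm 1ℚ M) (trans (cong (λ u → M + u) (sym (/-inverse m))) (lem₂ M z)))
    nz+z≡ : ℕtoℚ n * z + z ≡ ℕtoℚ (suc n) * z
    nz+z≡ = trans (lem₃ (ℕtoℚ n) z) (cong (_* z) (sym (ℕtoℚ-+ 1 n)))

  2/-below : ∀ {ε} → 0ℚ < ε → ∃ λ m → (+ 2) / suc m ≤ ε
  2/-below {mkℚ (+ zero) d _}    (*<* (ℤ.+<+ ()))
  2/-below {ε@(mkℚ +[1+ a ] d _)} _ = m , ≤-trans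
    (fromℚᵘ-mono-≤ {ℚᵘ.mkℚᵘ (+ 2) m} {ℚᵘ.mkℚᵘ +[1+ a ] d} (ℚᵘ.*≤* (ℤ.+≤+ le))) (≤-reflexive (fromℚᵘ-toℚᵘ ε))
    where
    -- m + 1 = 2(d + 1), so 2/(m+1) = 1/(d+1), and the numerator of ε is at least 1.
    m = d ℕ.+ suc d
    lem : ∀ d → 2 ℕ.* suc d ≡ suc (d ℕ.+ suc d)
    lem = ℕ-Solver.solve-∀
    le : 2 ℕ.* suc d ℕ.≤ suc a ℕ.* suc m
    le = ℕ.≤-trans (ℕ.≤-reflexive (lem d)) (ℕ.m≤n*m (suc m) (suc a))
  2/-below {mkℚ ℤ.-[1+ a ] d _} (*<* ())

  -- With M = m + 1: e^{(1+ε)Δ} ≥ e^{(M+2)Δ/M} ≥ (1 + 1/M)^{(M+2)Δ}.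
  q≤exp : ∀ {ε m} → (+ 2) / suc m ≤ ε → ∀ {a Δ} →
          a ℕ.* suc m ℕ.^ ((3 ℕ.+ m) ℕ.* Δ) ℕ.≤ suc (suc m) ℕ.^ ((3 ℕ.+ m) ℕ.* Δ) →
          ℕtoℚ a ≤exp ((1ℚ + ε) * ℕtoℚ Δ)
  q≤exp {ε} {m} 2/m≤ε {a} {Δ} le δ δ>0 = N , ≤-trans a≤ (p≤p+q (<⇒≤ δ>0))
    where
    open ≤-Reasoning
    N = (3 ℕ.+ m) ℕ.* Δ
    z = (+ 1) / suc m
    p = ℕtoℚ (suc m ℕ.^ N)
    p>0 : Positive p
    p>0 with suc m ℕ.^ N | ℕ.m^n>0 (suc m) N
    ... | suc q | _ = normalize-pos (suc q) 1
    lem : ∀ M D z → (M + ℕtoℚ 2) * D * z ≡ (M * z + ℕtoℚ 2 * z) * D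
    lem = solve-∀ ℚ-ring
    Nz≤ : ℕtoℚ N * z ≤ (1ℚ + ε) * ℕtoℚ Δ
    Nz≤ = begin
      ℕtoℚ N * z                                    ≡⟨ cong (_* z) (ℕtoℚ-* (3 ℕ.+ m) Δ) ⟩
      ℕtoℚ (3 ℕ.+ m) * ℕtoℚ Δ * z                   ≡⟨ cong (λ u → u * ℕtoℚ Δ * z) (trans (cong ℕtoℚ (ℕ.+-comm 2 (suc m))) (ℕtoℚ-+ (suc m) 2)) ⟩
      (ℕtoℚ (suc m) + ℕtoℚ 2) * ℕtoℚ Δ * z          ≡⟨ lem (ℕtoℚ (suc m)) (ℕtoℚ Δ) z ⟩
      (ℕtoℚ (suc m) * z + ℕtoℚ 2 * z) * ℕtoℚ Δ      ≡⟨ cong₂ (λ u v → (u + v) * ℕtoℚ Δ) (/-inverse m) (sym (/-unfold 2 m)) ⟩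
      (1ℚ + (+ 2) / suc m) * ℕtoℚ Δ                 ≤⟨ *-monoʳ-≤-nonNeg (ℕtoℚ Δ) {{nonNegative (ℕtoℚ≥0 Δ)}} (+-monoʳ-≤ 1ℚ 2/m≤ε) ⟩
      (1ℚ + ε) * ℕtoℚ Δ                             ∎
    a≤ : ℕtoℚ a ≤ expPartial ((1ℚ + ε) * ℕtoℚ Δ) N
    a≤ = *-cancelˡ-≤-pos p {{p>0}} (begin
      p * ℕtoℚ a                                   ≡⟨ *-comm p _ ⟩
      ℕtoℚ a * p                                   ≡⟨ ℕtoℚ-* a _ ⟨
      ℕtoℚ (a ℕ.* suc m ℕ.^ N)                     ≤⟨ ℕtoℚ-mono le ⟩
      ℕtoℚ (suc (suc m) ℕ.^ N)                     ≤⟨ [1+1/m]^n≤exp m N ⟩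
      p * expPartial (ℕtoℚ N * z) N                ≤⟨ *-monoˡ-≤-nonNeg p {{pos⇒nonNeg p {{p>0}}}} (expPartial-mono (*≥0 (ℕtoℚ≥0 N) (1/≥0 m)) Nz≤ N) ⟩
      p * expPartial ((1ℚ + ε) * ℕtoℚ Δ) N         ∎)

-- Assembly of the asymptotic bound

open import Data.Fin using (fromℕ<)
open import Data.Nat using (ℕ; suc; _≤_; _^_; >-nonZero⁻¹)
import Data.Nat as ℕ
import Data.Nat.Properties as ℕ
open import Data.Product using (Σ; ∃; _×_; _,_)
open import Data.Rational using (ℚ; _+_; _*_; 0ℚ; 1ℚ) renaming (_<_ to _<ℚ_)
open Colorings
open ParameterChoice
open Exponential using (2/-below; q≤exp)

degree≤ : ∀ {n} (G : Graph n) {Δ} → MaxDegree G Δ → ∀ u → degree G u ≤ Δ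
degree≤ {suc n} G (le , _) = le

module _ {s Δ : ℕ} (params : Parameters s Δ) where
  open Parameters params

  dp-colorable : ∀ {n} (G : Graph n) → TriangleFree G → (∀ u → degree G u ≤ Δ) → DPColorable G k
  dp-colorable G triangle-free deg C =
    Counting.coloring C triangle-free deg 2Δt≤ℓθ many-colors growth (fromℕ< k>0)
    where
    k>0 : 0 ℕ.< k
    k>0 = ℕ.<-≤-trans (>-nonZero⁻¹ _ {{ℕ.m*n≢0 (suc s) θ}}) (ℕ.≤-trans (ℕ.m≤n+m _ (2 ℕ.* ℓ ℕ.* y)) many-colors)

theorem1p4 : (ε : ℚ) → 0ℚ <ℚ ε →
    ∃ λ (Δ₀ : ℕ) → ∀ (n : ℕ) (G : Graph n) (Δ : ℕ) →
    TriangleFree G → MaxDegree G Δ → Δ₀ ≤ Δ →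
    ∃ λ (k : ℕ) → DPColorable G k × (ℕtoℚ (Δ ^ k) ≤exp ((1ℚ + ε) * ℕtoℚ Δ))
theorem1p4 ε ε>0 =
  let m , 2/m≤ε   = 2/-below ε>0
      -- With s = m + 1, the exponent (s+2)Δ in `few-colors` costs the factor 1 + 2/s ≤ 1 + ε.
      Δ₀ , params = parameters-exist (suc m)
  in Δ₀ , λ n G Δ triangle-free maxdeg Δ₀≤Δ →
    let p = params Δ Δ₀≤Δ
        k = Parameters.k p
    in k , dp-colorable p G triangle-free (degree≤ G maxdeg) ,
       q≤exp 2/m≤ε {Δ ^ k} {Δ} (Parameters.few-colors p)
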